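{- Let $F$ be an imaginary quadratic field with ring of integers $\mathcal{O}_F$, and let $A$ be a positive definite $2\times 2$ Hermitian matrix with complex entries (a positive definite binary Hermitian form). Then $\#\operatorname{Min}(A) \leq 12$.
   Context: Fix a complex embedding $F \hookrightarrow \mathbb{C}$, so that $\mathcal{O}_F^2 \subset \mathbb{C}^2$. For a $2\times 2$ Hermitian matrix $A$ and $x \in \mathbb{C}^2$, write $A[x] = \bar{x}^t A x$. For positive definite $A$, the minimum of $A$ is $\min(A) = \inf_{v \in \mathcal{O}_F^2 \setminus \{0\}} A[v]$ (which is positive), and a vector $v \in \mathcal{O}_F^2\setminus\{0\}$ is a minimal vector of $A$ if $A[v] = \min(A)$. The set $\operatorname{Min}(A)$ of minimal vectors is defined with the convention that, since $v$ is minimal if and only if $-v$ is, exactly one representative of each pair $\{\pm v\}$ is included in $\operatorname{Min}(A)$. -}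

module Defs where

open import Algebra.Bundles.Raw using (RawRing)
open import Algebra.Definitions.RawMonoid using (sum)
open import Algebra.Morphism.Structures using (IsRingMonomorphism)
open import Data.Fin.Base using (Fin)
open import Data.Integer.Base as ℤ using (ℤ)
open import Data.List.Base using (List; []; _∷_; length)
open import Data.List.Relation.Unary.Unique.Setoid using (Unique)
open import Data.Nat.Base as ℕ using (ℕ)
import Data.Nat.Divisibility as ℕ
import Data.Nat.Properties as ℕ
open import Data.Product.Base using (Σ-syntax; ∃-syntax; _×_; _,_; proj₁; proj₂)
open import Data.Rational.Base as ℚ using (ℚ; 0ℚ; 1ℚ; ½; ∣_∣)
import Data.Rational.Properties as ℚ
open import Data.Rational.Solver using (module +-*-Solver)
open import Data.Sum.Base using (_⊎_; inj₁; inj₂)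
open import Data.Vec.Functional using (Vector)
open import Function.Base using (_∘_)
open import Level using (0ℓ)
open import Relation.Binary.Bundles using (Setoid)
open import Relation.Binary.PropositionalEquality
  using (_≡_; refl; sym; trans; cong; cong₂; subst; module ≡-Reasoning)
open import Relation.Nullary using (¬_)

private
  triangle : ∀ p q r s → ∣ (p ℚ.+ q) ℚ.- (r ℚ.+ s) ∣ ℚ.≤ ∣ p ℚ.- r ∣ ℚ.+ ∣ q ℚ.- s ∣
  triangle p q r s = subst (λ t → ∣ t ∣ ℚ.≤ ∣ p ℚ.- r ∣ ℚ.+ ∣ q ℚ.- s ∣) (sym eq)
    (ℚ.∣p+q∣≤∣p∣+∣q∣ (p ℚ.- r) (q ℚ.- s))
    where
    open +-*-Solver
    eq : (p ℚ.+ q) ℚ.- (r ℚ.+ s) ≡ (p ℚ.- r) ℚ.+ (q ℚ.- s)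
    eq = solve 4 (λ p q r s → (p :+ q) :- (r :+ s) := (p :- r) :+ (q :- s)) refl p q r s

  half : ∀ ε → ε ℚ.* ½ ℚ.+ ε ℚ.* ½ ≡ ε
  half ε = trans (sym (ℚ.*-distribˡ-+ ε ½ ½)) (ℚ.*-identityʳ ε)

  half>0 : ∀ {ε} → 0ℚ ℚ.< ε → 0ℚ ℚ.< ε ℚ.* ½
  half>0 0<ε = ℚ.*-monoˡ-<-pos ½ 0<ε

  product-triangle : ∀ p q r s →
    ∣ p ℚ.* q ℚ.- r ℚ.* s ∣ ℚ.≤ ∣ p ∣ ℚ.* ∣ q ℚ.- s ∣ ℚ.+ ∣ s ∣ ℚ.* ∣ p ℚ.- r ∣
  product-triangle p q r s = begin
    ∣ p ℚ.* q ℚ.- r ℚ.* s ∣                                 ≡⟨ cong ∣_∣ eq ⟩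
    ∣ p ℚ.* (q ℚ.- s) ℚ.+ s ℚ.* (p ℚ.- r) ∣                 ≤⟨ ℚ.∣p+q∣≤∣p∣+∣q∣ (p ℚ.* (q ℚ.- s)) (s ℚ.* (p ℚ.- r)) ⟩
    ∣ p ℚ.* (q ℚ.- s) ∣ ℚ.+ ∣ s ℚ.* (p ℚ.- r) ∣             ≡⟨ cong₂ ℚ._+_ (ℚ.∣p*q∣≡∣p∣*∣q∣ p (q ℚ.- s)) (ℚ.∣p*q∣≡∣p∣*∣q∣ s (p ℚ.- r)) ⟩
    ∣ p ∣ ℚ.* ∣ q ℚ.- s ∣ ℚ.+ ∣ s ∣ ℚ.* ∣ p ℚ.- r ∣         ∎
    where
    open ℚ.≤-Reasoning
    open +-*-Solver
    eq : p ℚ.* q ℚ.- r ℚ.* s ≡ p ℚ.* (q ℚ.- s) ℚ.+ s ℚ.* (p ℚ.- r)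
    eq = solve 4 (λ p q r s → p :* q :- r :* s := p :* (q :- s) :+ s :* (p :- r)) refl p q r s

-- ℝ as Cauchy sequences of rationals, modulo the equality _≈ℝ_.

Cauchy : (ℕ → ℚ) → Set
Cauchy x = ∀ ε → 0ℚ ℚ.< ε →
  ∃[ N ] (∀ m n → N ℕ.≤ m → N ℕ.≤ n → ∣ x m ℚ.- x n ∣ ℚ.< ε)

record ℝ : Set where
  constructor mkℝ
  field
    seq    : ℕ → ℚ
    cauchy : Cauchy seq

open ℝ public

infix 4 _≈ℝ_ _<ℝ_ _≤ℝ_

_≈ℝ_ : ℝ → ℝ → Set
x ≈ℝ y = ∀ ε → 0ℚ ℚ.< ε → ∃[ N ] (∀ n → N ℕ.≤ n → ∣ seq x n ℚ.- seq y n ∣ ℚ.< ε)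

_<ℝ_ : ℝ → ℝ → Set
x <ℝ y = ∃[ ε ] (0ℚ ℚ.< ε × ∃[ N ] (∀ n → N ℕ.≤ n → seq x n ℚ.+ ε ℚ.< seq y n))

_≤ℝ_ : ℝ → ℝ → Set
x ≤ℝ y = ∀ ε → 0ℚ ℚ.< ε → ∃[ N ] (∀ n → N ℕ.≤ n → seq x n ℚ.< seq y n ℚ.+ ε)

fromℚ : ℚ → ℝ
fromℚ q = mkℝ (λ _ → q)
  λ ε 0<ε → 0 , λ _ _ _ _ → subst (λ t → ∣ t ∣ ℚ.< ε) (sym (ℚ.+-inverseʳ q)) 0<ε

infixl 6 _+ℝ_
infixl 7 _*ℝ_
infix  8 -ℝ_

_+ℝ_ : ℝ → ℝ → ℝ
x +ℝ y = mkℝ (λ n → seq x n ℚ.+ seq y n) λ ε 0<ε →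
  let N₁ , h₁ = cauchy x (ε ℚ.* ½) (half>0 0<ε)
      N₂ , h₂ = cauchy y (ε ℚ.* ½) (half>0 0<ε)
  in N₁ ℕ.⊔ N₂ , λ m n N≤m N≤n →
     subst (∣ (seq x m ℚ.+ seq y m) ℚ.- (seq x n ℚ.+ seq y n) ∣ ℚ.<_) (half ε)
       (ℚ.≤-<-trans (triangle (seq x m) (seq y m) (seq x n) (seq y n))
         (ℚ.+-mono-<
           (h₁ m n (ℕ.m⊔n≤o⇒m≤o N₁ N₂ N≤m) (ℕ.m⊔n≤o⇒m≤o N₁ N₂ N≤n))
           (h₂ m n (ℕ.m⊔n≤o⇒n≤o N₁ N₂ N≤m) (ℕ.m⊔n≤o⇒n≤o N₁ N₂ N≤n))))

-ℝ_ : ℝ → ℝ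
-ℝ x = mkℝ (λ n → ℚ.- seq x n) λ ε 0<ε →
  let N , h = cauchy x ε 0<ε
  in N , λ m n N≤m N≤n → subst (ℚ._< ε) (flip (seq x m) (seq x n)) (h m n N≤m N≤n)
  where
  open +-*-Solver
  flip : ∀ p q → ∣ p ℚ.- q ∣ ≡ ∣ (ℚ.- p) ℚ.- (ℚ.- q) ∣
  flip p q = trans (sym (ℚ.∣-p∣≡∣p∣ (p ℚ.- q)))
    (cong ∣_∣ (solve 2 (λ p q → :- (p :- q) := (:- p) :- (:- q)) refl p q))

eventually-bounded : ∀ x →
  ∃[ B ] (0ℚ ℚ.< B × ∃[ N ] (∀ n → N ℕ.≤ n → ∣ seq x n ∣ ℚ.≤ B))
eventually-bounded x = ∣ c ∣ ℚ.+ 1ℚ , 0<B , N , bound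
  where
  N : ℕ
  N = proj₁ (cauchy x 1ℚ (ℚ.positive⁻¹ 1ℚ))
  c : ℚ
  c = seq x N
  0<B : 0ℚ ℚ.< ∣ c ∣ ℚ.+ 1ℚ
  0<B = ℚ.+-mono-≤-< (ℚ.nonNegative⁻¹ ∣ c ∣ {{ℚ.∣-∣-nonNeg c}}) (ℚ.positive⁻¹ 1ℚ)
  open +-*-Solver
  bound : ∀ n → N ℕ.≤ n → ∣ seq x n ∣ ℚ.≤ ∣ c ∣ ℚ.+ 1ℚ
  bound n N≤n = begin
    ∣ seq x n ∣                        ≡⟨ cong ∣_∣ (solve 2 (λ p q → p := q :+ (p :- q)) refl (seq x n) c) ⟩
    ∣ c ℚ.+ (seq x n ℚ.- c) ∣          ≤⟨ ℚ.∣p+q∣≤∣p∣+∣q∣ c (seq x n ℚ.- c) ⟩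
    ∣ c ∣ ℚ.+ ∣ seq x n ℚ.- c ∣        ≤⟨ ℚ.+-monoʳ-≤ ∣ c ∣ (ℚ.<⇒≤ (proj₂ (cauchy x 1ℚ (ℚ.positive⁻¹ 1ℚ)) n N N≤n ℕ.≤-refl)) ⟩
    ∣ c ∣ ℚ.+ 1ℚ                       ∎
    where open ℚ.≤-Reasoning

private
  split : ∀ ε B C → 0ℚ ℚ.< ε → 0ℚ ℚ.< B → 0ℚ ℚ.< C →
    ∃[ δ ] (0ℚ ℚ.< δ × B ℚ.* δ ℚ.+ C ℚ.* δ ≡ ε)
  split ε B C 0<ε 0<B 0<C = go (B ℚ.+ C) refl {{ℚ.positive (ℚ.+-mono-< 0<B 0<C)}}
    where
    go : ∀ D → B ℚ.+ C ≡ D → .{{ℚ.Positive D}} → ∃[ δ ] (0ℚ ℚ.< δ × B ℚ.* δ ℚ.+ C ℚ.* δ ≡ ε)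
    go D B+C≡D = ε ℚ.* D⁻¹ , 0<δ , total
      where
      D⁻¹ : ℚ
      D⁻¹ = (ℚ.1/ D) {{ℚ.pos⇒nonZero D}}
      0<δ : 0ℚ ℚ.< ε ℚ.* D⁻¹
      0<δ = subst (ℚ._< ε ℚ.* D⁻¹) (ℚ.*-zeroˡ D⁻¹)
        (ℚ.*-monoˡ-<-pos D⁻¹ {{ℚ.1/pos⇒pos D}} 0<ε)
      open ≡-Reasoning
      total : B ℚ.* (ε ℚ.* D⁻¹) ℚ.+ C ℚ.* (ε ℚ.* D⁻¹) ≡ ε
      total = begin
        B ℚ.* (ε ℚ.* D⁻¹) ℚ.+ C ℚ.* (ε ℚ.* D⁻¹) ≡⟨ ℚ.*-distribʳ-+ (ε ℚ.* D⁻¹) B C ⟨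
        (B ℚ.+ C) ℚ.* (ε ℚ.* D⁻¹)               ≡⟨ cong (ℚ._* (ε ℚ.* D⁻¹)) B+C≡D ⟩
        D ℚ.* (ε ℚ.* D⁻¹)                       ≡⟨ cong (D ℚ.*_) (ℚ.*-comm ε D⁻¹) ⟩
        D ℚ.* (D⁻¹ ℚ.* ε)                       ≡⟨ ℚ.*-assoc D D⁻¹ ε ⟨
        (D ℚ.* D⁻¹) ℚ.* ε                       ≡⟨ cong (ℚ._* ε) (ℚ.*-inverseʳ D {{ℚ.pos⇒nonZero D}}) ⟩
        1ℚ ℚ.* ε                                ≡⟨ ℚ.*-identityˡ ε ⟩
        ε                                       ∎

  scale : ∀ p t D δ → 0ℚ ℚ.< D → ∣ p ∣ ℚ.≤ D → ∣ t ∣ ℚ.< δ → ∣ p ∣ ℚ.* ∣ t ∣ ℚ.< D ℚ.* δ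
  scale p t D δ 0<D p≤D t<δ = ℚ.≤-<-trans
    (ℚ.*-monoʳ-≤-nonNeg ∣ t ∣ {{ℚ.∣-∣-nonNeg t}} p≤D)
    (ℚ.*-monoʳ-<-pos D {{ℚ.positive 0<D}} t<δ)

  product-close : ∀ {B C δ ε} p q r s → 0ℚ ℚ.< B → 0ℚ ℚ.< C → B ℚ.* δ ℚ.+ C ℚ.* δ ≡ ε →
    ∣ p ∣ ℚ.≤ B → ∣ s ∣ ℚ.≤ C → ∣ p ℚ.- r ∣ ℚ.< δ → ∣ q ℚ.- s ∣ ℚ.< δ →
    ∣ p ℚ.* q ℚ.- r ℚ.* s ∣ ℚ.< ε
  product-close {B} {C} {δ} p q r s 0<B 0<C total p≤B s≤C p≈r q≈s =
    subst (∣ p ℚ.* q ℚ.- r ℚ.* s ∣ ℚ.<_) total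
      (ℚ.≤-<-trans (product-triangle p q r s)
        (ℚ.+-mono-< (scale p (q ℚ.- s) B δ 0<B p≤B q≈s) (scale s (p ℚ.- r) C δ 0<C s≤C p≈r)))

  below : ∀ k l m n {o} → (k ℕ.⊔ l) ℕ.⊔ (m ℕ.⊔ n) ℕ.≤ o → k ℕ.≤ o × l ℕ.≤ o × m ℕ.≤ o × n ℕ.≤ o
  below k l m n h =
    ℕ.m⊔n≤o⇒m≤o k l kl , ℕ.m⊔n≤o⇒n≤o k l kl , ℕ.m⊔n≤o⇒m≤o m n mn , ℕ.m⊔n≤o⇒n≤o m n mn
    where
    kl = ℕ.m⊔n≤o⇒m≤o (k ℕ.⊔ l) (m ℕ.⊔ n) h
    mn = ℕ.m⊔n≤o⇒n≤o (k ℕ.⊔ l) (m ℕ.⊔ n) h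

_*ℝ_ : ℝ → ℝ → ℝ
x *ℝ y = mkℝ (λ n → seq x n ℚ.* seq y n) λ ε 0<ε →
  let B , 0<B , K , x≤B = eventually-bounded x
      C , 0<C , L , y≤C = eventually-bounded y
      δ , 0<δ , total   = split ε B C 0<ε 0<B 0<C
      N₁ , h₁           = cauchy x δ 0<δ
      N₂ , h₂           = cauchy y δ 0<δ
  in (K ℕ.⊔ L) ℕ.⊔ (N₁ ℕ.⊔ N₂) , λ m n M≤m M≤n →
     let K≤m , _   , N₁≤m , N₂≤m = below K L N₁ N₂ M≤m
         _   , L≤n , N₁≤n , N₂≤n = below K L N₁ N₂ M≤n
     in product-close (seq x m) (seq y m) (seq x n) (seq y n) 0<B 0<C total
          (x≤B m K≤m) (y≤C n L≤n) (h₁ m n N₁≤m N₁≤n) (h₂ m n N₂≤m N₂≤n)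

0ℝ 1ℝ : ℝ
0ℝ = fromℚ 0ℚ
1ℝ = fromℚ 1ℚ

record ℂ : Set where
  constructor _+i_
  field
    re im : ℝ

open ℂ public

infix 4 _≈ℂ_

_≈ℂ_ : ℂ → ℂ → Set
z ≈ℂ w = re z ≈ℝ re w × im z ≈ℝ im w

ℂ-rawRing : RawRing 0ℓ 0ℓ
ℂ-rawRing = record
  { Carrier = ℂ
  ; _≈_     = _≈ℂ_
  ; _+_     = λ z w → (re z +ℝ re w) +i (im z +ℝ im w)
  ; _*_     = λ z w → (re z *ℝ re w +ℝ -ℝ (im z *ℝ im w)) +i (re z *ℝ im w +ℝ im z *ℝ re w)
  ; -_      = λ z → (-ℝ re z) +i (-ℝ im z)
  ; 0#      = 0ℝ +i 0ℝ
  ; 1#      = 1ℝ +i 0ℝ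
  }

conj : ℂ → ℂ
conj z = re z +i (-ℝ im z)

-- Being nonzero in the positive sense ∣z∣² > 0, which implies ¬ (z ≈ 0) and is
-- classically equivalent to it.
NonZeroℂ : ℂ → Set
NonZeroℂ z = 0ℝ <ℝ re z *ℝ re z +ℝ im z *ℝ im z

Matrix₂ : Set
Matrix₂ = Fin 2 → Fin 2 → ℂ

Hermitian : Matrix₂ → Set
Hermitian A = ∀ i j → A i j ≈ℂ conj (A j i)

-- x̄ᵗ A x.  It is real for Hermitian A, so that taking the real part only
-- changes the codomain from ℂ to ℝ.
_[_] : Matrix₂ → Vector ℂ 2 → ℝ
A [ x ] = re (∑ λ i → ∑ λ j → conj (x i) * A i j * x j)
  where
  open RawRing ℂ-rawRing using (_*_; +-rawMonoid)
  ∑ : Vector ℂ 2 → ℂ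
  ∑ = sum +-rawMonoid

PositiveDefinite : Matrix₂ → Set
PositiveDefinite A = ∀ x → ∃[ i ] NonZeroℂ (x i) → 0ℝ <ℝ A [ x ]

-- In particular 0 is not squarefree.
Squarefree : ℕ → Set
Squarefree d = ∀ k → k ℕ.* k ℕ.∣ d → k ≡ 1

-- ℚ(√-d), the element rat + irr·√-d being given by its two coordinates.  The
-- imaginary quadratic fields are these for squarefree d.
record ℚ√- (d : ℕ) : Set where
  constructor _+√_
  field
    rat irr : ℚ

open ℚ√- public

module _ (d : ℕ) where

  ℚ√-rawRing : RawRing 0ℓ 0ℓ
  ℚ√-rawRing = record
    { Carrier = ℚ√- d
    ; _≈_     = _≡_
    ; _+_     = λ x y → (rat x ℚ.+ rat y) +√ (irr x ℚ.+ irr y)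
    ; _*_     = λ x y → (rat x ℚ.* rat y ℚ.- (ℤ.+ d ℚ./ 1) ℚ.* (irr x ℚ.* irr y))
                        +√ (rat x ℚ.* irr y ℚ.+ irr x ℚ.* rat y)
    ; -_      = λ x → (ℚ.- rat x) +√ (ℚ.- irr x)
    ; 0#      = 0ℚ +√ 0ℚ
    ; 1#      = 1ℚ +√ 0ℚ
    }

  IsComplexEmbedding : (ℚ√- d → ℂ) → Set
  IsComplexEmbedding = IsRingMonomorphism ℚ√-rawRing ℂ-rawRing

module _ {d : ℕ} where

  open RawRing (ℚ√-rawRing d) using (_+_; _*_; -_; 0#; 1#)

  -- evalMonic (c₀ ∷ … ∷ cₙ₋₁ ∷ []) x = c₀ + c₁ x + … + cₙ₋₁ xⁿ⁻¹ + xⁿ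
  evalMonic : List ℤ → ℚ√- d → ℚ√- d
  evalMonic []       x = 1#
  evalMonic (c ∷ cs) x = ((c ℚ./ 1) +√ 0ℚ) + x * evalMonic cs x

  -- Membership in the ring of integers, the integral closure of ℤ in ℚ(√-d).
  IsIntegral : ℚ√- d → Set
  IsIntegral x = ∃[ cs ] evalMonic cs x ≡ 0#

  -- Membership in 𝒪² ∖ {0}.
  NonzeroIntegral : Vector (ℚ√- d) 2 → Set
  NonzeroIntegral v = (∀ i → IsIntegral (v i)) × ¬ (∀ i → v i ≡ 0#)

  module _ (σ : ℚ√- d → ℂ) (A : Matrix₂) where

    -- m = min(A), the infimum of A[v] over 𝒪² ∖ {0}.
    IsMin : ℝ → Set
    IsMin m = (∀ v → NonzeroIntegral v → m ≤ℝ A [ σ ∘ v ])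
            × (∀ b → (∀ v → NonzeroIntegral v → b ≤ℝ A [ σ ∘ v ]) → b ≤ℝ m)

    IsMinimalVector : Vector (ℚ√- d) 2 → Set
    IsMinimalVector v = NonzeroIntegral v × ∃[ m ] (IsMin m × A [ σ ∘ v ] ≈ℝ m)

  _≈±_ : Vector (ℚ√- d) 2 → Vector (ℚ√- d) 2 → Set
  v ≈± w = (∀ i → v i ≡ w i) ⊎ (∀ i → v i ≡ - w i)

  private
    neg-involutive : ∀ x → - (- x) ≡ x
    neg-involutive x = cong₂ _+√_ (ℚ-neg-involutive (rat x)) (ℚ-neg-involutive (irr x))
      where
      open +-*-Solver using (solve; _:=_; :-_)
      ℚ-neg-involutive : ∀ q → ℚ.- (ℚ.- q) ≡ q
      ℚ-neg-involutive = solve 1 (λ q → :- (:- q) := q) refl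

  ≈±-refl : ∀ {v} → v ≈± v
  ≈±-refl = inj₁ λ _ → refl

  ≈±-sym : ∀ {v w} → v ≈± w → w ≈± v
  ≈±-sym         (inj₁ e) = inj₁ λ i → sym (e i)
  ≈±-sym {w = w} (inj₂ e) = inj₂ λ i → sym (trans (cong -_ (e i)) (neg-involutive (w i)))

  ≈±-trans : ∀ {u v w} → u ≈± v → v ≈± w → u ≈± w
  ≈±-trans         (inj₁ e) (inj₁ f) = inj₁ λ i → trans (e i) (f i)
  ≈±-trans         (inj₁ e) (inj₂ f) = inj₂ λ i → trans (e i) (f i)
  ≈±-trans         (inj₂ e) (inj₁ f) = inj₂ λ i → trans (e i) (cong -_ (f i))
  ≈±-trans {w = w} (inj₂ e) (inj₂ f) =
    inj₁ λ i → trans (e i) (trans (cong -_ (f i)) (neg-involutive (w i)))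

  -- One representative of each pair {±v} is the same as a minimal vector up to
  -- sign, so Min(A) is the setoid of minimal vectors with v and -v identified.
  Min : (ℚ√- d → ℂ) → Matrix₂ → Setoid 0ℓ 0ℓ
  Min σ A = record
    { Carrier       = Σ[ v ∈ Vector (ℚ√- d) 2 ] IsMinimalVector σ A v
    ; _≈_           = λ v w → proj₁ v ≈± proj₁ w
    ; isEquivalence = record
      { refl  = λ {v} → ≈±-refl {proj₁ v}
      ; sym   = λ {v} {w} → ≈±-sym {proj₁ v} {proj₁ w}
      ; trans = λ {u} {v} {w} → ≈±-trans {proj₁ u} {proj₁ v} {proj₁ w}
      }
    }

-- #S ≤ n: a list of pairwise inequivalent elements of S has at most n entries.
#_≤_ : Setoid 0ℓ 0ℓ → ℕ → Set
# S ≤ n = (xs : List (Setoid.Carrier S)) → Unique S xs → length xs ℕ.≤ n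

{-# OPTIONS --safe #-}

-- The minimal vectors of A are those of a lattice L ≅ ℤ⁴ with respect to a
-- positive quadratic form q of minimum m.  If a, b, c are zero or minimal and
-- a + b + c = 2u with u ∈ L, then q u, q (u - a), q (u - b), q (u - c) sum to
-- q a + q b + q c ≤ 3m, so one of these four vectors is zero: c = ± a ± b.
-- Hence ± pairs of minimal vectors have distinct nonzero classes in L/2L = 𝔽₂⁴,
-- and B a b = ±m for the polar form B when a, b and a + b are all congruent to
-- minimal vectors.  The classes cannot fill a hyperplane {a, b, c, d = a + b, …}:
-- for then B d c = ± B a c ± B b c with all three terms ±m.  So the other nonzero
-- classes meet every hyperplane, there are at least three of them, and at most
-- 15 - 3 = 12 classes remain.

module Submission where

open import Defs
open import Algebra.Bundles using (AbelianGroup; CommutativeRing; RawRing)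
open import Algebra.Construct.DirectProduct using (abelianGroup)
open import Algebra.Morphism.Structures using (module RingMorphisms)
import Algebra.Properties.AbelianGroup as AbelianGroupProperties
import Algebra.Properties.CommutativeSemigroup as CommutativeSemigroupProperties
import Algebra.Properties.Semiring.Exp as Exp
import Algebra.Solver.CommutativeMonoid as CommutativeMonoidSolver
open import Data.Bool.Base using (Bool; true; false; _xor_)
import Data.Bool.Properties as Bool
open import Data.Fin.Base using (Fin; zero; suc; combine)
open import Data.Fin.Properties using (combine-injective; injective⇒≤)
open import Data.Integer.Base as ℤ using (ℤ; 0ℤ; 1ℤ)
import Data.Integer.DivMod as ℤ
import Data.Integer.Properties as ℤ
open import Data.Integer.Solver using () renaming (module +-*-Solver to ℤ-Solver)
open import Data.List.Base using (List; []; _∷_; length; lookup; concatMap; map; _++_)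
import Data.List.Membership.DecPropositional as DecMembership
open import Data.List.Membership.Propositional using (_∈_; _∉_; find)
open import Data.List.Membership.Propositional.Properties using (∈-lookup; ∈-map⁻)
open import Data.List.Properties using (length-map)
open import Data.List.Relation.Unary.All as All using (All; []; _∷_; all?; universal)
open import Data.List.Relation.Unary.All.Properties using (¬All⇒Any¬; ¬Any⇒All¬; map⁺)
open import Data.List.Relation.Unary.AllPairs as AllPairs using ([]; _∷_)
import Data.List.Relation.Unary.AllPairs.Properties as AllPairs
open import Data.List.Relation.Unary.Any using (Any; any?)
open import Data.List.Relation.Unary.Unique.Propositional using () renaming (Unique to ≡-Unique)
open import Data.Nat.Base as ℕ using (ℕ; zero; suc; s≤s; z≤n)
open import Data.Nat.Coprimality as Coprime using (Coprime; coprime-divisor)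
import Data.Nat.Divisibility as ℕ
import Data.Nat.DivMod as ℕ
import Data.Nat.Properties as ℕ
open import Data.Product.Base using (∃-syntax; _×_; _,_; proj₁; proj₂)
open import Data.Product.Relation.Binary.Pointwise.NonDependent using (×-decidable)
open import Data.Rational.Base as ℚ using (ℚ; mkℚ; 0ℚ; 1ℚ; ½; ∣_∣; ↥_; ↧_; ↧ₙ_)
open import Data.Rational.Literals using (fromℤ)
import Data.Rational.Properties as ℚ
open import Data.Rational.Solver using () renaming (module +-*-Solver to ℚ-Solver)
import Data.Rational.Unnormalised.Base as ℚᵘ
import Data.Rational.Unnormalised.Properties as ℚᵘ
open import Data.Sign.Base as Sign using (Sign)
open import Data.Sum.Base using (inj₁; inj₂)
open import Data.Vec.Base using (Vec; []; _∷_; zipWith; replicate)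
open import Data.Vec.Functional using (Vector)
open import Data.Vec.Properties using (zipWith-identityʳ; ≡-dec; ∷-injective)
open import Function.Base using (_∘_; flip)
open import Level using (0ℓ)
open import Relation.Binary.Bundles using (Setoid)
open import Relation.Binary.Core using (Rel)
open import Relation.Binary.Definitions using (Decidable; DecidableEquality; tri<; tri≈; tri>)
open import Relation.Binary.PropositionalEquality as ≡ using (_≡_; _≢_)
import Relation.Binary.Reasoning.Setoid as ≈-Reasoning
open import Relation.Nullary using (¬_; Dec; yes; no; ¬?; contradiction; map′; _×-dec_; _→-dec_)
open import Relation.Nullary.Decidable using (False; toWitness; toWitnessFalse)
open import Relation.Unary as Unary using (Pred)

-- Short vectors of a lattice

-- Equality and order of Cauchy reals are undecidable, and this shapes the argument. The case
-- distinctions of the lattice argument concern lattice vectors, classes and signs, never real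
-- values: that B a b is ±m is read off from the relation c = ±a ± b in ℤ⁴, not from an estimate of
-- ∣B a b∣. Likewise no minimum of A is computed. A nonempty list of minimal vectors brings one
-- along, and its positivity rests on ∣σ x∣² > 0 for x ≠ 0, which comes from an inverse of x in
-- ℚ(√-d). The lattice has to be found first, since 𝒪 is given only as the set of roots of monic
-- polynomials. A root x has one common denominator c for all its powers, so N(c) N(x)ᵏ is an
-- integer for every k, and hence N(x) is one. The same holds for x + 1, which yields the trace.
-- Squarefreeness of d and the equation T² + d Y² = 4N modulo 4 then give 𝒪 = ℤ + ℤω, and 𝒪² ≅ ℤ⁴.
-- The form is pulled back to ℤ⁴ along σ as an additive map, without computing σ(√-d).

infixl 6 _⊕_

_⊕_ : ∀ {n} → Vec Bool n → Vec Bool n → Vec Bool n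
_⊕_ = zipWith _xor_

⊕-same : ∀ {n} (v : Vec Bool n) → v ⊕ v ≡ replicate n false
⊕-same []      = ≡.refl
⊕-same (b ∷ v) = ≡.cong₂ _∷_ (Bool.xor-same b) (⊕-same v)

module Signed (G : AbelianGroup 0ℓ 0ℓ) where

  open AbelianGroup G
  open AbelianGroupProperties G

  infixr 8 _◃_

  -- Signs act on the lattice and on ℝ alike, so that the signs in c = ±a ± b can be carried through
  -- the form to those in B a b = ±m.
  _◃_ : Sign → Carrier → Carrier
  Sign.+ ◃ x = x
  Sign.- ◃ x = x ⁻¹

  ◃-cong : ∀ s {x y} → x ≈ y → s ◃ x ≈ s ◃ y
  ◃-cong Sign.+ x≈y = x≈y
  ◃-cong Sign.- x≈y = ⁻¹-cong x≈y

  ◃-assoc : ∀ s t x → s ◃ t ◃ x ≈ (s Sign.* t) ◃ x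
  ◃-assoc Sign.+ t      x = refl
  ◃-assoc Sign.- Sign.+ x = refl
  ◃-assoc Sign.- Sign.- x = ⁻¹-involutive x

  ◃-involutive : ∀ s x → s ◃ s ◃ x ≈ x
  ◃-involutive Sign.+ x = refl
  ◃-involutive Sign.- x = ⁻¹-involutive x

  ◃-ε : ∀ s → s ◃ ε ≈ ε
  ◃-ε Sign.+ = refl
  ◃-ε Sign.- = ε⁻¹≈ε

module _ (R G : AbelianGroup 0ℓ 0ℓ) where

  private
    module R where
      open AbelianGroup R public
      open AbelianGroupProperties R public
      open Signed R public
      open CommutativeMonoidSolver commutativeMonoid public using (solve; _⊜_) renaming (_⊕_ to infixl 6 _⊞_)

  open R using () renaming (_∙_ to infixl 6 _+_; _⁻¹ to infix 8 -_; _≈_ to infix 4 _≃_)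
  open AbelianGroup G
  open AbelianGroupProperties G
  open Signed G

  record Biadditive (f : Carrier → Carrier → R.Carrier) : Set where
    field
      cong     : ∀ {x x′ y y′} → x ≈ x′ → y ≈ y′ → f x y ≃ f x′ y′
      distribˡ : ∀ x y z → f (x ∙ y) z ≃ f x z + f y z
      distribʳ : ∀ x y z → f x (y ∙ z) ≃ f x y + f x z

    open ≈-Reasoning R.setoid

    zeroˡ : ∀ y → f ε y ≃ R.ε
    zeroˡ y = R.identityʳ-unique (f ε y) (f ε y) (begin
      f ε y + f ε y ≈⟨ distribˡ ε ε y ⟨
      f (ε ∙ ε) y   ≈⟨ cong (identityˡ ε) refl ⟩
      f ε y         ∎)

    zeroʳ : ∀ x → f x ε ≃ R.ε
    zeroʳ x = R.identityʳ-unique (f x ε) (f x ε) (begin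
      f x ε + f x ε ≈⟨ distribʳ x ε ε ⟨
      f x (ε ∙ ε)   ≈⟨ cong refl (identityˡ ε) ⟩
      f x ε         ∎)

    ⁻¹-distribˡ : ∀ x y → f (x ⁻¹) y ≃ - f x y
    ⁻¹-distribˡ x y = R.inverseʳ-unique (f x y) (f (x ⁻¹) y) (begin
      f x y + f (x ⁻¹) y ≈⟨ distribˡ x (x ⁻¹) y ⟨
      f (x ∙ x ⁻¹) y     ≈⟨ cong (inverseʳ x) refl ⟩
      f ε y              ≈⟨ zeroˡ y ⟩
      R.ε                ∎)

    ⁻¹-distribʳ : ∀ x y → f x (y ⁻¹) ≃ - f x y
    ⁻¹-distribʳ x y = R.inverseʳ-unique (f x y) (f x (y ⁻¹)) (begin
      f x y + f x (y ⁻¹) ≈⟨ distribʳ x y (y ⁻¹) ⟨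
      f x (y ∙ y ⁻¹)     ≈⟨ cong refl (inverseʳ y) ⟩
      f x ε              ≈⟨ zeroʳ x ⟩
      R.ε                ∎)

    ◃-distribˡ : ∀ s x y → f (s ◃ x) y ≃ s R.◃ f x y
    ◃-distribˡ Sign.+ x y = R.refl
    ◃-distribˡ Sign.- x y = ⁻¹-distribˡ x y

    ◃-distribʳ : ∀ s x y → f x (s ◃ y) ≃ s R.◃ f x y
    ◃-distribʳ Sign.+ x y = R.refl
    ◃-distribʳ Sign.- x y = ⁻¹-distribʳ x y

  -- Used twice: for the polar form, which is `f` plus its flip, and for assembling the Hermitian
  -- form from its four entries.
  biadditive-+ : ∀ {f g} → Biadditive f → Biadditive g → Biadditive (λ x y → f x y + g x y)
  biadditive-+ {f} {g} F G = record
    { cong     = λ x≈x′ y≈y′ → R.∙-cong (F.cong x≈x′ y≈y′) (G.cong x≈x′ y≈y′)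
    ; distribˡ = λ x y z → R.trans (R.∙-cong (F.distribˡ x y z) (G.distribˡ x y z))
                   (interchange (f x z) (f y z) (g x z) (g y z))
    ; distribʳ = λ x y z → R.trans (R.∙-cong (F.distribʳ x y z) (G.distribʳ x y z))
                   (interchange (f x y) (f x z) (g x y) (g x z))
    }
    where
    module F = Biadditive F
    module G = Biadditive G
    open CommutativeSemigroupProperties R.commutativeSemigroup using (interchange)

  biadditive-flip : ∀ {f} → Biadditive f → Biadditive (flip f)
  biadditive-flip F = record
    { cong     = λ x≈x′ y≈y′ → cong y≈y′ x≈x′
    ; distribˡ = λ x y z → distribʳ z x y
    ; distribʳ = λ x y z → distribˡ y z x
    }
    where open Biadditive F

  -- The reals enter only as an abelian group with a compatible relation `_≼_`, and the only
  -- decision taken is equality of lattice vectors. The hypothesis `x+m⋠x` expresses m > 0, and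
  -- `±m±m≄±m` says that no odd combination ±m ± m ± m vanishes.
  module ShortVectors
    (_≼_ : Rel R.Carrier 0ℓ)
    (≼-reflexive : ∀ {x y} → x ≃ y → x ≼ y)
    (≼-trans : ∀ {x y z} → x ≼ y → y ≼ z → x ≼ z)
    (+-mono-≼ : ∀ {x x′ y y′} → x ≼ x′ → y ≼ y′ → (x + y) ≼ (x′ + y′))
    {m : R.Carrier} (0≼m : R.ε ≼ m) (x+m⋠x : ∀ {x} → ¬ (x + m) ≼ x)
    (±m±m≄±m : ∀ s t r → ¬ s R.◃ m + t R.◃ m ≃ r R.◃ m)
    (_≟_ : Decidable _≈_)
    {f : Carrier → Carrier → R.Carrier} (f-biadditive : Biadditive f)
    (m≼f : ∀ u → ¬ u ≈ ε → m ≼ f u u)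
    {n : ℕ} (class : Carrier → Vec Bool n) (class-ε : class ε ≡ replicate n false)
    (half : ∀ a b c → class c ≡ class a ⊕ class b → ∃[ u ] a ∙ b ∙ c ≈ u ∙ u)
    where

    private
      module F = Biadditive f-biadditive
      module B = Biadditive (biadditive-+ f-biadditive (biadditive-flip f-biadditive))

      q : Carrier → R.Carrier
      q x = f x x

      B : Carrier → Carrier → R.Carrier
      B x y = f x y + f y x

    Short Minimal : Carrier → Set
    Short x   = q x ≼ m
    Minimal x = q x ≃ m

    q-∙ : ∀ x y → q (x ∙ y) ≃ (q x + q y) + B x y
    q-∙ x y = begin
      f (x ∙ y) (x ∙ y)                     ≈⟨ F.distribˡ x y (x ∙ y) ⟩
      f x (x ∙ y) + f y (x ∙ y)             ≈⟨ R.∙-cong (F.distribʳ x x y) (F.distribʳ y x y) ⟩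
      (q x + f x y) + (f y x + q y)         ≈⟨ R.solve 4 (λ a b c d →
          (a R.⊞ b) R.⊞ (c R.⊞ d) R.⊜ (a R.⊞ d) R.⊞ (b R.⊞ c)) R.refl (q x) (f x y) (f y x) (q y) ⟩
      (q x + q y) + (f x y + f y x)         ∎
      where open ≈-Reasoning R.setoid

    q-◃ : ∀ s x → q (s ◃ x) ≃ q x
    q-◃ s x = begin
      f (s ◃ x) (s ◃ x)    ≈⟨ F.◃-distribˡ s x (s ◃ x) ⟩
      s R.◃ f x (s ◃ x)    ≈⟨ R.◃-cong s (F.◃-distribʳ s x x) ⟩
      s R.◃ s R.◃ q x      ≈⟨ R.◃-involutive s (q x) ⟩
      q x                  ∎
      where open ≈-Reasoning R.setoid

    -- The cross terms B u (-a), B u (-b), B u (-c) add up to -B u (2u) = -4 q u, which cancels the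
    -- four copies of q u.
    four-vectors : ∀ a b c u → a ∙ b ∙ c ≈ u ∙ u →
      q u + q (u - a) + q (u - b) + q (u - c) ≃ q a + q b + q c
    four-vectors a b c u eq = begin
      q u + q (u - a) + q (u - b) + q (u - c)
        ≈⟨ R.∙-cong (R.∙-cong (R.∙-congˡ (q-- a)) (q-- b)) (q-- c) ⟩
      q u + (q u + q a + B u (a ⁻¹)) + (q u + q b + B u (b ⁻¹)) + (q u + q c + B u (c ⁻¹))
        ≈⟨ R.solve 7 (λ u a b c x y z →
             u R.⊞ (u R.⊞ a R.⊞ x) R.⊞ (u R.⊞ b R.⊞ y) R.⊞ (u R.⊞ c R.⊞ z)
             R.⊜ a R.⊞ b R.⊞ c R.⊞ ((u R.⊞ u) R.⊞ (u R.⊞ u) R.⊞ (x R.⊞ y R.⊞ z))) R.refl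
             (q u) (q a) (q b) (q c) (B u (a ⁻¹)) (B u (b ⁻¹)) (B u (c ⁻¹)) ⟩
      q a + q b + q c + (B u u + B u u + (B u (a ⁻¹) + B u (b ⁻¹) + B u (c ⁻¹)))
        ≈⟨ R.∙-congˡ (R.∙-cong (B.distribʳ u u u)
             (R.trans (B.distribʳ u (a ⁻¹ ∙ b ⁻¹) (c ⁻¹)) (R.∙-congʳ (B.distribʳ u (a ⁻¹) (b ⁻¹))))) ⟨
      q a + q b + q c + (B u (u ∙ u) + B u (a ⁻¹ ∙ b ⁻¹ ∙ c ⁻¹))
        ≈⟨ R.∙-congˡ (R.∙-congˡ (R.trans (B.cong refl inverse-sum) (B.⁻¹-distribʳ u (u ∙ u)))) ⟩
      q a + q b + q c + (B u (u ∙ u) + - B u (u ∙ u))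
        ≈⟨ R.∙-congˡ (R.inverseʳ (B u (u ∙ u))) ⟩
      q a + q b + q c + R.ε
        ≈⟨ R.identityʳ _ ⟩
      q a + q b + q c ∎
      where
      open ≈-Reasoning R.setoid
      q-- : ∀ x → q (u - x) ≃ q u + q x + B u (x ⁻¹)
      q-- x = R.trans (q-∙ u (x ⁻¹)) (R.∙-congʳ (R.∙-congˡ (q-◃ Sign.- x)))
      inverse-sum : a ⁻¹ ∙ b ⁻¹ ∙ c ⁻¹ ≈ (u ∙ u) ⁻¹
      inverse-sum = trans (∙-congʳ (⁻¹-∙-comm a b)) (trans (⁻¹-∙-comm (a ∙ b) c) (⁻¹-cong eq))

    -- The norms of u, u - a, u - b, u - c add up to those of a, b, c, hence
    -- these four vectors cannot all be nonzero.
    short-relation : ∀ {a b c} → Short a → Short b → Short c →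
      class c ≡ class a ⊕ class b → ∃[ s ] ∃[ t ] c ≈ s ◃ a ∙ t ◃ b
    short-relation {a} {b} {c} qa≼m qb≼m qc≼m eq with half a b c eq
    ... | u , abc≈uu with u ≟ ε | u ≟ a | u ≟ b | u ≟ c
    ...   | yes u≈ε | _ | _ | _ = Sign.- , Sign.- , (begin
      c               ≈⟨ inverseʳ-unique (a ∙ b) c (trans abc≈uu (trans (∙-cong u≈ε u≈ε) (identityˡ ε))) ⟩
      (a ∙ b) ⁻¹      ≈⟨ ⁻¹-∙-comm a b ⟨
      a ⁻¹ ∙ b ⁻¹     ∎)
      where open ≈-Reasoning setoid
    ...   | no _ | yes u≈a | _ | _ = Sign.+ , Sign.- , (begin
      c               ≈⟨ xyx⁻¹≈y b c ⟨
      b ∙ c ∙ b ⁻¹    ≈⟨ ∙-congʳ (∙-cancelˡ a (b ∙ c) a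
                           (trans (sym (assoc a b c)) (trans abc≈uu (∙-cong u≈a u≈a)))) ⟩
      a ∙ b ⁻¹        ∎)
      where open ≈-Reasoning setoid
    ...   | no _ | no _ | yes u≈b | _ = Sign.- , Sign.+ , (begin
      c               ≈⟨ xyx⁻¹≈y a c ⟨
      a ∙ c ∙ a ⁻¹    ≈⟨ ∙-congʳ (∙-cancelˡ b (a ∙ c) b
                           (trans (sym (assoc b a c)) (trans (∙-congʳ (comm b a)) (trans abc≈uu (∙-cong u≈b u≈b))))) ⟩
      b ∙ a ⁻¹        ≈⟨ comm b (a ⁻¹) ⟩
      a ⁻¹ ∙ b        ∎)
      where open ≈-Reasoning setoid
    ...   | no _ | no _ | no _ | yes u≈c = Sign.+ , Sign.+ ,
      sym (∙-cancelʳ c (a ∙ b) c (trans abc≈uu (∙-cong u≈c u≈c)))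
    ...   | no u≉ε | no u≉a | no u≉b | no u≉c = contradiction
      (≼-trans (+-mono-≼ (+-mono-≼ (+-mono-≼ (m≼f u u≉ε) (large u≉a)) (large u≉b)) (large u≉c))
        (≼-trans (≼-reflexive (four-vectors a b c u abc≈uu)) (+-mono-≼ (+-mono-≼ qa≼m qb≼m) qc≼m)))
      x+m⋠x
      where
      large : ∀ {x} → ¬ u ≈ x → m ≼ q (u - x)
      large u≉x = m≼f _ λ u-x≈ε → u≉x (x∙y⁻¹≈ε⇒x≈y u _ u-x≈ε)

    ε-short : Short ε
    ε-short = ≼-trans (≼-reflexive (F.zeroˡ ε)) 0≼m

    minimal-short : ∀ {x} → Minimal x → Short x
    minimal-short = ≼-reflexive

    -- Zero is short, so it may serve as the second vector in `short-relation`, which then reads a =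
    -- ±b ± 0.
    class-injective : ∀ {a b} → Minimal a → Minimal b → class a ≡ class b → ∃[ s ] a ≈ s ◃ b
    class-injective {a} {b} a-min b-min eq
      with short-relation (minimal-short b-min) ε-short (minimal-short a-min) (begin
        class a                       ≡⟨ eq ⟩
        class b                       ≡⟨ zipWith-identityʳ Bool.xor-identityʳ (class b) ⟨
        class b ⊕ replicate n false   ≡⟨ ≡.cong (class b ⊕_) class-ε ⟨
        class b ⊕ class ε             ∎)
      where open ≡.≡-Reasoning
    ... | s , t , a≈ = s , trans a≈ (trans (∙-congˡ (◃-ε t)) (identityʳ (s ◃ b)))

    -- With zero for both given vectors, `short-relation` would force a = 0, whereas q a = m is
    -- positive.
    class-nonzero : ∀ {a} → Minimal a → class a ≢ replicate n false
    class-nonzero {a} a-min eq with short-relation ε-short ε-short (minimal-short a-min)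
        (≡.trans eq (≡.sym (⊕-same (class ε))))
    ... | s , t , a≈ = x+m⋠x {R.ε} (≼-reflexive (begin
      R.ε + m  ≈⟨ R.identityˡ m ⟩
      m        ≈⟨ a-min ⟨
      f a a    ≈⟨ F.cong a≈ε a≈ε ⟩
      f ε ε    ≈⟨ F.zeroˡ ε ⟩
      R.ε      ∎))
      where
      open ≈-Reasoning R.setoid
      a≈ε : a ≈ ε
      a≈ε = trans a≈ (trans (∙-cong (◃-ε s) (◃-ε t)) (identityˡ ε))

    -- Since c = ±a ± b, expanding q c gives m = m + m ± B a b.
    B≃±m : ∀ {a b c} → Minimal a → Minimal b → Minimal c →
      class c ≡ class a ⊕ class b → ∃[ s ] B a b ≃ s R.◃ m
    B≃±m {a} {b} {c} a-min b-min c-min eq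
      with short-relation (minimal-short a-min) (minimal-short b-min) (minimal-short c-min) eq
    ... | s , t , c≈ = st Sign.* Sign.- , (begin
      B a b                         ≈⟨ R.◃-involutive st (B a b) ⟨
      st R.◃ st R.◃ B a b           ≈⟨ R.◃-cong st (R.inverseʳ-unique m (st R.◃ B a b) m+stB≃0) ⟩
      st R.◃ Sign.- R.◃ m           ≈⟨ R.◃-assoc st Sign.- m ⟩
      (st Sign.* Sign.-) R.◃ m      ∎)
      where
      open ≈-Reasoning R.setoid
      st = s Sign.* t
      m+stB≃0 : m + st R.◃ B a b ≃ R.ε
      m+stB≃0 = R.∙-cancelˡ m _ _ (begin
        m + (m + st R.◃ B a b)                       ≈⟨ R.assoc m m _ ⟨
        m + m + st R.◃ B a b                         ≈⟨ R.∙-cong (R.∙-cong (R.trans (q-◃ s a) a-min) (R.trans (q-◃ t b) b-min))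
                                                          (R.◃-assoc s t (B a b)) ⟨
        q (s ◃ a) + q (t ◃ b) + s R.◃ t R.◃ B a b    ≈⟨ R.∙-congˡ (R.trans (B.◃-distribˡ s a (t ◃ b)) (R.◃-cong s (B.◃-distribʳ t a b))) ⟨
        q (s ◃ a) + q (t ◃ b) + B (s ◃ a) (t ◃ b)    ≈⟨ q-∙ (s ◃ a) (t ◃ b) ⟨
        q (s ◃ a ∙ t ◃ b)                            ≈⟨ F.cong c≈ c≈ ⟨
        q c                                          ≈⟨ c-min ⟩
        m                                            ≈⟨ R.identityʳ m ⟨
        m + R.ε                                      ∎)

    -- B (a ± b) c = B a c ± B b c, where all three terms would be ±m.
    no-minimal-plane : ∀ {a b c d ac bc dc} →
      Minimal a → Minimal b → Minimal c → Minimal d → Minimal ac → Minimal bc → Minimal dc →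
      class d  ≡ class a ⊕ class b →
      class ac ≡ class a ⊕ class c →
      class bc ≡ class b ⊕ class c →
      ¬ class dc ≡ class d ⊕ class c
    no-minimal-plane {a} {b} {c} {d} a-min b-min c-min d-min ac-min bc-min dc-min d≡ ac≡ bc≡ dc≡
      with short-relation (minimal-short a-min) (minimal-short b-min) (minimal-short d-min) d≡
         | B≃±m a-min c-min ac-min ac≡ | B≃±m b-min c-min bc-min bc≡ | B≃±m d-min c-min dc-min dc≡
    ... | s , t , d≈ | r₁ , Bac≃ | r₂ , Bbc≃ | r₃ , Bdc≃ = ±m±m≄±m (s Sign.* r₁) (t Sign.* r₂) r₃ (begin
      (s Sign.* r₁) R.◃ m + (t Sign.* r₂) R.◃ m  ≈⟨ R.∙-cong (R.◃-assoc s r₁ m) (R.◃-assoc t r₂ m) ⟨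
      s R.◃ r₁ R.◃ m + t R.◃ r₂ R.◃ m            ≈⟨ R.∙-cong (R.◃-cong s Bac≃) (R.◃-cong t Bbc≃) ⟨
      s R.◃ B a c + t R.◃ B b c                  ≈⟨ R.∙-cong (B.◃-distribˡ s a c) (B.◃-distribˡ t b c) ⟨
      B (s ◃ a) c + B (t ◃ b) c                  ≈⟨ B.distribˡ (s ◃ a) (t ◃ b) c ⟨
      B (s ◃ a ∙ t ◃ b) c                        ≈⟨ B.cong d≈ refl ⟨
      B d c                                      ≈⟨ Bdc≃ ⟩
      r₃ R.◃ m                                   ∎)
      where open ≈-Reasoning R.setoid

-- Common denominators

module _ (R : CommutativeRing 0ℓ 0ℓ) where

  open CommutativeRing R

  -- Serves for the subring ℤ[√-d] of ℚ(√-d), where regular means of nonzero norm.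
  module CommonDenominators
    (S : Pred Carrier 0ℓ)
    (S-resp : ∀ {x y} → x ≈ y → S x → S y)
    (S-+ : ∀ {x y} → S x → S y → S (x + y))
    (S-* : ∀ {x y} → S x → S y → S (x * y))
    (S-neg : ∀ {x} → S x → S (- x))
    (S-0 : S 0#) (S-1 : S 1#)
    (Regular : Pred Carrier 0ℓ)
    (regular-* : ∀ x y → Regular x → Regular y → Regular (x * y))
    (regular-1 : Regular 1#)
    (clear : ∀ x → ∃[ c ] S c × Regular c × S (c * x))
    where

    open Exp semiring public using (_^_)
    open AbelianGroupProperties +-abelianGroup using (xyx⁻¹≈y)
    open ≈-Reasoning setoid

    evalMonicAt : List Carrier → Carrier → Carrier
    evalMonicAt []       x = 1#
    evalMonicAt (c ∷ cs) x = c + x * evalMonicAt cs x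

    -- Complete integrality over S: a single denominator serves all powers of x. Unlike a monic
    -- equation, this passes at once from x to x + 1 and to norms.
    AlmostIntegral : Carrier → Set
    AlmostIntegral x = ∃[ c ] Regular c × (∀ k → S (c * x ^ k))

    -- The denominators of the single powers are multiplied together. They lie in S themselves, so
    -- each factor keeps inside S what the others have cleared.
    clear-powers : ∀ x n → ∃[ c ] S c × Regular c × (∀ i → i ℕ.< n → S (c * x ^ i))
    clear-powers x zero    = 1# , S-1 , regular-1 , λ _ ()
    clear-powers x (suc n) with clear-powers x n | clear (x ^ n)
    ... | b , Sb , b-regular , Sbxⁱ | c , Sc , c-regular , Scxⁿ =
      b * c , S-* Sb Sc , regular-* b c b-regular c-regular , Sbcxⁱ
      where
      Sbcxⁱ : ∀ i → i ℕ.< suc n → S (b * c * x ^ i)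
      Sbcxⁱ i (s≤s i≤n) with ℕ.m≤n⇒m<n∨m≡n i≤n
      ... | inj₁ i<n  = S-resp (trans (sym (*-assoc c b (x ^ i))) (*-congʳ (*-comm c b))) (S-* Sc (Sbxⁱ i i<n))
      ... | inj₂ ≡.refl = S-resp (sym (*-assoc b c (x ^ i))) (S-* Sb Scxⁿ)

    -- All terms of y times the polynomial below the leading one lie in S. They are removed one at a
    -- time: subtract the constant term y c, then absorb a factor x into y.
    leading-term : ∀ {cs} → All S cs → ∀ x y → (∀ i → i ℕ.< length cs → S (y * x ^ i)) →
      S (y * evalMonicAt cs x) → S (y * x ^ length cs)
    leading-term []                 x y Syxⁱ Sy = Sy
    leading-term {c ∷ cs} (Sc ∷ Scs) x y Syxⁱ Sy = S-resp (*-assoc y x (x ^ length cs))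
      (leading-term Scs x (y * x)
        (λ i i<n → S-resp (sym (*-assoc y x (x ^ i))) (Syxⁱ (suc i) (s≤s i<n)))
        (S-resp cancel (S-+ Sy (S-neg (S-* (S-resp (*-identityʳ y) (Syxⁱ 0 (s≤s z≤n))) Sc)))))
      where
      e : Carrier
      e = evalMonicAt cs x
      cancel : y * (c + x * e) + - (y * c) ≈ y * x * e
      cancel = begin
        y * (c + x * e) + - (y * c)        ≈⟨ +-congʳ (distribˡ y c (x * e)) ⟩
        y * c + y * (x * e) + - (y * c)    ≈⟨ xyx⁻¹≈y (y * c) (y * (x * e)) ⟩
        y * (x * e)                        ≈⟨ *-assoc y x e ⟨
        y * x * e                          ∎

    *^-suc : ∀ c x k → c * x ^ suc k ≈ c * x ^ k * x
    *^-suc c x k = trans (*-congˡ (*-comm x (x ^ k))) (sym (*-assoc c (x ^ k) x))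

    -- A denominator c that clears a window of consecutive powers of x, longer than the degree,
    -- clears every later power too: multiplied by c xᵏ⁺¹, the monic equation expresses the next
    -- power by those in the window, which thus slides up by one.
    root⇒almostIntegral : ∀ {cs x} → All S cs → evalMonicAt cs x ≈ 0# → AlmostIntegral x
    -- One power more than the degree, so that the window contains the exponent 0 even when `cs` is
    -- empty.
    root⇒almostIntegral {cs} {x} Scs root with clear-powers x (suc (length cs))
    ... | c , _ , c-regular , Scxⁱ = c , c-regular , λ k → S-resp (*-identityʳ (c * x ^ k)) (window k 0 (s≤s z≤n))
      where
      shift : ∀ k i → c * x ^ k * x ^ suc i ≈ c * x ^ suc k * x ^ i
      shift k i = begin
        c * x ^ k * (x * x ^ i)  ≈⟨ *-assoc (c * x ^ k) x (x ^ i) ⟨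
        c * x ^ k * x * x ^ i    ≈⟨ *-congʳ (*^-suc c x k) ⟨
        c * x ^ suc k * x ^ i    ∎
      window : ∀ k i → i ℕ.< suc (length cs) → S (c * x ^ k * x ^ i)
      window zero    i i<n = S-resp (*-congʳ (sym (*-identityʳ c))) (Scxⁱ i i<n)
      window (suc k) i (s≤s i≤n) with ℕ.m≤n⇒m<n∨m≡n i≤n
      ... | inj₁ i<n  = S-resp (shift k i) (window k (suc i) (s≤s i<n))
      ... | inj₂ ≡.refl = leading-term Scs x (c * x ^ suc k)
        (λ i i<n → S-resp (shift k i) (window k (suc i) (s≤s i<n)))
        (S-resp (sym (trans (*-congˡ root) (zeroʳ (c * x ^ suc k)))) S-0)

    -- The same c works, because (x + 1)ᵏ is a sum of powers of x. The spare factor xⁱ in `go` makes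
    -- the induction on k close: multiplying by x + 1 splits into the exponents i + 1 and i.
    almostIntegral-suc : ∀ {x} → AlmostIntegral x → AlmostIntegral (x + 1#)
    almostIntegral-suc {x} (c , c-regular , Scxᵏ) = c , c-regular , λ k → S-resp (*-congˡ (*-identityʳ ((x + 1#) ^ k))) (go k 0)
      where
      go : ∀ k i → S (c * ((x + 1#) ^ k * x ^ i))
      go zero    i = S-resp (*-congˡ (sym (*-identityˡ (x ^ i)))) (Scxᵏ i)
      go (suc k) i = S-resp (begin
        c * (y * x ^ suc i) + c * (y * x ^ i)     ≈⟨ distribˡ c _ _ ⟨
        c * (y * x ^ suc i + y * x ^ i)           ≈⟨ *-congˡ (+-congʳ (trans (sym (*-assoc y x (x ^ i))) (*-congʳ (*-comm y x)))) ⟩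
        c * (x * y * x ^ i + y * x ^ i)           ≈⟨ *-congˡ (distribʳ (x ^ i) (x * y) y) ⟨
        c * ((x * y + y) * x ^ i)                 ≈⟨ *-congˡ (*-congʳ (+-congˡ (*-identityˡ y))) ⟨
        c * ((x * y + 1# * y) * x ^ i)            ≈⟨ *-congˡ (*-congʳ (distribʳ y x 1#)) ⟨
        c * ((x + 1#) * y * x ^ i)                ∎) (S-+ (go k (suc i)) (go k i))
        where
        y = (x + 1#) ^ k

open ≡ using (refl; sym; trans; cong; cong₂; subst; subst₂; ≢-sym; isEquivalence; module ≡-Reasoning)

-- Hyperplanes of 𝔽₂⁴

lookup-injective : ∀ {A : Set} {xs : List A} → ≡-Unique xs → ∀ {i j} → lookup xs i ≡ lookup xs j → i ≡ j
lookup-injective (x∉ ∷ u) {zero}  {zero}  eq = refl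
lookup-injective (x∉ ∷ u) {zero}  {suc j} eq = contradiction eq (All.lookup x∉ (∈-lookup j))
lookup-injective (x∉ ∷ u) {suc i} {zero}  eq = contradiction (sym eq) (All.lookup x∉ (∈-lookup i))
lookup-injective (x∉ ∷ u) {suc i} {suc j} eq = cong suc (lookup-injective u eq)

digit : Bool → Fin 2
digit false = zero
digit true  = suc zero

digit-injective : ∀ {b c} → digit b ≡ digit c → b ≡ c
digit-injective {false} {false} eq = refl
digit-injective {true}  {true}  eq = refl

binary : ∀ {n} → Vec Bool n → Fin (2 ℕ.^ n)
binary []      = zero
binary (b ∷ v) = combine (digit b) (binary v)

binary-injective : ∀ {n} {v w : Vec Bool n} → binary v ≡ binary w → v ≡ w
binary-injective {v = []}    {[]}    eq = refl
binary-injective {v = b ∷ v} {c ∷ w} eq with combine-injective (digit b) (binary v) (digit c) (binary w) eq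
... | b≡c , v≡w = cong₂ _∷_ (digit-injective b≡c) (binary-injective v≡w)

unique-length : ∀ {n} {vs : List (Vec Bool n)} → ≡-Unique vs → length vs ℕ.≤ 2 ℕ.^ n
unique-length u = injective⇒≤ (lookup-injective u ∘ binary-injective)

-- Makes quantification over 𝔽₂ⁿ decidable, so that `avoiding-hyperplane` can be settled by
-- evaluation.
∀-vec? : ∀ {n} {P : Pred (Vec Bool n) 0ℓ} → Unary.Decidable P → Dec (∀ v → P v)
∀-vec? {zero}  P? = map′ (λ { p [] → p }) (λ h → h []) (P? [])
∀-vec? {suc n} P? = map′ (λ { (f , t) (false ∷ v) → f v ; (f , t) (true ∷ v) → t v })
  (λ h → h ∘ (false ∷_) , h ∘ (true ∷_)) (∀-vec? (P? ∘ (false ∷_)) ×-dec ∀-vec? (P? ∘ (true ∷_)))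

Point : Set
Point = Vec Bool 4

O : Point
O = replicate 4 false

_≟_ : DecidableEquality Point
_≟_ = ≡-dec Bool._≟_

-- Bases of the hyperplanes of 𝔽₂⁴, in reduced echelon form.
hyperplanes : List (Point × Point × Point)
hyperplanes =
  concatMap (λ x → concatMap (λ y → map (λ z →
      (true  ∷ false ∷ false ∷ x     ∷ []) ,
      (false ∷ true  ∷ false ∷ y     ∷ []) ,
      (false ∷ false ∷ true  ∷ z     ∷ [])) bits) bits) bits
  ++ concatMap (λ x → map (λ y →
      (true  ∷ false ∷ x     ∷ false ∷ []) ,
      (false ∷ true  ∷ y     ∷ false ∷ []) ,
      (false ∷ false ∷ false ∷ true  ∷ [])) bits) bits
  ++ map (λ x →
      (true  ∷ x     ∷ false ∷ false ∷ []) ,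
      (false ∷ false ∷ true  ∷ false ∷ []) ,
      (false ∷ false ∷ false ∷ true  ∷ [])) bits
  ++ ((false ∷ true  ∷ false ∷ false ∷ []) ,
      (false ∷ false ∷ true  ∷ false ∷ []) ,
      (false ∷ false ∷ false ∷ true  ∷ [])) ∷ []
  where
  bits : List Bool
  bits = false ∷ true ∷ []

-- Zero is left out of the hyperplane, as it is never the class of a minimal vector. The order of
-- the other seven points is the one matched in `no-realised-hyperplane`.
span : Point × Point × Point → List Point
span (a , b , c) = a ∷ b ∷ c ∷ a ⊕ b ∷ a ⊕ c ∷ b ⊕ c ∷ (a ⊕ b) ⊕ c ∷ []

Avoids : Point → Point → Point → Set
Avoids p q r = r ≢ O × r ≢ p × r ≢ q

-- Two nonzero points over 𝔽₂ are equal or independent, so some linear functional takes the value 1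
-- at both, and its kernel avoids them. The proof tries the fifteen kernels for each pair.
avoiding-hyperplane : ∀ p → p ≢ O → ∀ q → q ≢ O → Any (All (Avoids p q) ∘ span) hyperplanes
avoiding-hyperplane = toWitness {a? = ∀-vec? λ p → ¬? (p ≟ O) →-dec ∀-vec? λ q → ¬? (q ≟ O) →-dec
  any? (all? (λ r → ¬? (r ≟ O) ×-dec ¬? (r ≟ p) ×-dec ¬? (r ≟ q)) ∘ span) hyperplanes} _

-- The complement of vs is a blocking set for the hyperplanes, hence has three
-- nonzero points.
no-hyperplane⇒length≤12 : ∀ {vs : List Point} → ≡-Unique vs → All (_≢ O) vs →
  (∀ h → ¬ All (_∈ vs) (span h)) → length vs ℕ.≤ 12
-- Prepending O, p, q, r to `vs` gives a list of distinct points of 𝔽₂⁴, hence 4 + `length vs` ≤ 16.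
no-hyperplane⇒length≤12 {vs} unique nonzero no-hyperplane = ℕ.+-cancelˡ-≤ 4 (length vs) 12 (unique-length
      (((≢-sym p≢O ∷ ≢-sym q≢O ∷ ≢-sym r≢O ∷ All.map ≢-sym nonzero) ∷ (≢-sym q≢p ∷ ≢-sym r≢p ∷ ¬Any⇒All¬ vs p∉vs) ∷
       (≢-sym r≢q ∷ ¬Any⇒All¬ vs q∉vs) ∷ ¬Any⇒All¬ vs r∉vs ∷ unique)))
  where
  open DecMembership _≟_ using (_∈?_)
  blocked : ∀ p → p ≢ O → ∀ q → q ≢ O → ∃[ r ] r ∉ vs × Avoids p q r
  blocked p p≢O q q≢O =
    let h , _ , avoids = find (avoiding-hyperplane p p≢O q q≢O)
        r , r∈h , r∉vs = find (¬All⇒Any¬ (_∈? vs) (span h) (no-hyperplane h))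
    in r , r∉vs , All.lookup avoids r∈h
  1111≢O : (true ∷ true ∷ true ∷ true ∷ []) ≢ O
  1111≢O ()
  -- The first missing point has only zero to avoid, so an arbitrary nonzero point fills both slots.
  first  = blocked _ 1111≢O _ 1111≢O
  p      = proj₁ first
  p∉vs   = proj₁ (proj₂ first)
  p≢O    = proj₁ (proj₂ (proj₂ first))
  second = blocked p p≢O p p≢O
  q      = proj₁ second
  q∉vs   = proj₁ (proj₂ second)
  q≢O    = proj₁ (proj₂ (proj₂ second))
  q≢p    = proj₁ (proj₂ (proj₂ (proj₂ second)))
  third  = blocked p p≢O q q≢O
  r      = proj₁ third
  r∉vs   = proj₁ (proj₂ third)
  r≢O    = proj₁ (proj₂ (proj₂ third))
  r≢p    = proj₁ (proj₂ (proj₂ (proj₂ third)))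
  r≢q    = proj₂ (proj₂ (proj₂ (proj₂ third)))

-- Real numbers

infix 4 _≃_ _≼_

-- Wrappers of _≈ℝ_ and _≤ℝ_, which unfold too eagerly for x and y to be inferred.
record _≃_ (x y : ℝ) : Set where
  constructor approx
  field close : x ≈ℝ y

record _≼_ (x y : ℝ) : Set where
  constructor bound
  field below : x ≤ℝ y

open _≃_ public
open _≼_ public

Eventually : (ℕ → Set) → Set
Eventually P = ∃[ N ] (∀ n → N ℕ.≤ n → P n)

always : ∀ {P : ℕ → Set} → (∀ n → P n) → Eventually P
always h = 0 , λ n _ → h n

infixl 4 _<$>_ _<*>_

_<$>_ : ∀ {P Q : ℕ → Set} → (∀ {n} → P n → Q n) → Eventually P → Eventually Q
f <$> (N , h) = N , λ n N≤n → f (h n N≤n)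

_<*>_ : ∀ {P Q : ℕ → Set} → Eventually (λ n → P n → Q n) → Eventually P → Eventually Q
(M , f) <*> (N , h) = M ℕ.⊔ N , λ n M⊔N≤n → f n (ℕ.m⊔n≤o⇒m≤o M N M⊔N≤n) (h n (ℕ.m⊔n≤o⇒n≤o M N M⊔N≤n))

extract : ∀ {P : Set} → Eventually (λ _ → P) → P
extract (N , h) = h N ℕ.≤-refl

p≤∣p∣ : ∀ p → p ℚ.≤ ∣ p ∣
p≤∣p∣ p with ℚ.≤-total 0ℚ p
... | inj₁ 0≤p = ℚ.≤-reflexive (sym (ℚ.0≤p⇒∣p∣≡p 0≤p))
... | inj₂ p≤0 = ℚ.≤-trans p≤0 (ℚ.0≤∣p∣ p)

∣p-q∣≡∣q-p∣ : ∀ p q → ∣ p ℚ.- q ∣ ≡ ∣ q ℚ.- p ∣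
∣p-q∣≡∣q-p∣ p q = trans (cong ∣_∣ (solve 2 (λ p q → p :- q := :- (q :- p)) refl p q)) (ℚ.∣-p∣≡∣p∣ (q ℚ.- p))
  where open ℚ-Solver

½>0 : ∀ {ε} → 0ℚ ℚ.< ε → 0ℚ ℚ.< ε ℚ.* ½
½>0 = ℚ.*-monoˡ-<-pos ½

½+½ : ∀ ε → ε ℚ.* ½ ℚ.+ ε ℚ.* ½ ≡ ε
½+½ ε = trans (sym (ℚ.*-distribˡ-+ ε ½ ½)) (ℚ.*-identityʳ ε)

pointwise : ∀ {x y} → (∀ n → seq x n ≡ seq y n) → x ≃ y
pointwise {x} {y} eq = approx λ ε 0<ε → always λ n → subst (λ t → ∣ t ∣ ℚ.< ε)
  (sym (trans (cong (ℚ._- seq y n) (eq n)) (ℚ.+-inverseʳ (seq y n)))) 0<ε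

≃-sym : ∀ {x y} → x ≃ y → y ≃ x
≃-sym {x} {y} (approx x≈y) = approx λ ε 0<ε → (λ {n} → subst (ℚ._< ε) (∣p-q∣≡∣q-p∣ (seq x n) (seq y n))) <$> x≈y ε 0<ε

sum-of-halves : ∀ {p q r ε} → ∣ r ∣ ℚ.≤ ∣ p ∣ ℚ.+ ∣ q ∣ → ∣ p ∣ ℚ.< ε ℚ.* ½ → ∣ q ∣ ℚ.< ε ℚ.* ½ → ∣ r ∣ ℚ.< ε
sum-of-halves {ε = ε} r≤ p< q< = ℚ.≤-<-trans r≤ (subst (_ ℚ.<_) (½+½ ε) (ℚ.+-mono-< p< q<))

≃-trans : ∀ {x y z} → x ≃ y → y ≃ z → x ≃ z
≃-trans {x} {y} {z} (approx x≈y) (approx y≈z) = approx λ ε 0<ε →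
  (λ {n} → sum-of-halves (lemma (seq x n) (seq y n) (seq z n))) <$> x≈y _ (½>0 0<ε) <*> y≈z _ (½>0 0<ε)
  where
  open ℚ-Solver
  lemma : ∀ p q r → ∣ p ℚ.- r ∣ ℚ.≤ ∣ p ℚ.- q ∣ ℚ.+ ∣ q ℚ.- r ∣
  lemma p q r = subst (λ t → ∣ t ∣ ℚ.≤ ∣ p ℚ.- q ∣ ℚ.+ ∣ q ℚ.- r ∣)
    (solve 3 (λ p q r → (p :- q) :+ (q :- r) := p :- r) refl p q r)
    (ℚ.∣p+q∣≤∣p∣+∣q∣ (p ℚ.- q) (q ℚ.- r))

+-cong : ∀ {x x′ y y′} → x ≃ x′ → y ≃ y′ → x +ℝ y ≃ x′ +ℝ y′
+-cong {x} {x′} {y} {y′} (approx x≈x′) (approx y≈y′) = approx λ ε 0<ε →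
  (λ {n} → sum-of-halves (lemma (seq x n) (seq x′ n) (seq y n) (seq y′ n))) <$> x≈x′ _ (½>0 0<ε) <*> y≈y′ _ (½>0 0<ε)
  where
  open ℚ-Solver
  lemma : ∀ p p′ q q′ → ∣ (p ℚ.+ q) ℚ.- (p′ ℚ.+ q′) ∣ ℚ.≤ ∣ p ℚ.- p′ ∣ ℚ.+ ∣ q ℚ.- q′ ∣
  lemma p p′ q q′ = subst (λ t → ∣ t ∣ ℚ.≤ ∣ p ℚ.- p′ ∣ ℚ.+ ∣ q ℚ.- q′ ∣)
    (solve 4 (λ p p′ q q′ → (p :- p′) :+ (q :- q′) := (p :+ q) :- (p′ :+ q′)) refl p p′ q q′)
    (ℚ.∣p+q∣≤∣p∣+∣q∣ (p ℚ.- p′) (q ℚ.- q′))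

-‿cong : ∀ {x y} → x ≃ y → -ℝ x ≃ -ℝ y
-‿cong {x} {y} (approx x≈y) = approx λ ε 0<ε → (λ {n} → subst (ℚ._< ε) (lemma (seq x n) (seq y n))) <$> x≈y ε 0<ε
  where
  open ℚ-Solver
  lemma : ∀ p q → ∣ p ℚ.- q ∣ ≡ ∣ (ℚ.- p) ℚ.- (ℚ.- q) ∣
  lemma p q = trans (∣p-q∣≡∣q-p∣ p q) (cong ∣_∣ (solve 2 (λ p q → q :- p := (:- p) :- (:- q)) refl p q))

reciprocal : ∀ {p} → 0ℚ ℚ.< p → ∃[ q ] (0ℚ ℚ.< q × p ℚ.* q ≡ 1ℚ)
reciprocal {p} 0<p = ℚ.1/ p , ℚ.positive⁻¹ _ {{ℚ.1/pos⇒pos p}} , ℚ.*-inverseʳ p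
  where instance
    p>0 = ℚ.positive 0<p
    p≢0 = ℚ.pos⇒nonZero p

*-mono-≤-< : ∀ {p q r s} → 0ℚ ℚ.< q → 0ℚ ℚ.≤ r → p ℚ.≤ q → r ℚ.< s → p ℚ.* r ℚ.< q ℚ.* s
*-mono-≤-< {p} {q} {r} {s} 0<q 0≤r p≤q r<s = ℚ.≤-<-trans
  (ℚ.*-monoʳ-≤-nonNeg r {{ℚ.nonNegative 0≤r}} p≤q) (ℚ.*-monoʳ-<-pos q {{ℚ.positive 0<q}} r<s)

-- If B eventually bounds ∣x∣, the tolerance ε / B for the second factor suffices.
*-congˡ : ∀ {x y y′} → y ≃ y′ → x *ℝ y ≃ x *ℝ y′
*-congˡ {x} {y} {y′} (approx y≈y′) = approx λ ε 0<ε →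
  let B , 0<B , x≤B = eventually-bounded x
      C , 0<C , BC≡1 = reciprocal 0<B
      0<Cε = subst (ℚ._< C ℚ.* ε) (ℚ.*-zeroʳ C) (ℚ.*-monoʳ-<-pos C {{ℚ.positive 0<C}} 0<ε)
      cancel = trans (sym (ℚ.*-assoc B C ε)) (trans (cong (ℚ._* ε) BC≡1) (ℚ.*-identityˡ ε))
  in (λ {n} ∣x∣≤B ∣y-y′∣< → subst (∣ _ ∣ ℚ.<_) cancel (subst (ℚ._< _) (sym (lemma (seq x n) (seq y n) (seq y′ n)))
       (*-mono-≤-< 0<B (ℚ.0≤∣p∣ (seq y n ℚ.- seq y′ n)) ∣x∣≤B ∣y-y′∣<)))
     <$> x≤B <*> y≈y′ (C ℚ.* ε) 0<Cε
  where
  open ℚ-Solver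
  lemma : ∀ p q r → ∣ p ℚ.* q ℚ.- p ℚ.* r ∣ ≡ ∣ p ∣ ℚ.* ∣ q ℚ.- r ∣
  lemma p q r = trans (cong ∣_∣ (solve 3 (λ p q r → p :* q :- p :* r := p :* (q :- r)) refl p q r))
    (ℚ.∣p*q∣≡∣p∣*∣q∣ p (q ℚ.- r))

-- Opaque copies of the operations, whose unfolding makes unification very slow.
opaque

  infixl 6 _⊞_
  infixl 7 _⊠_
  infix  8 ⊟_

  _⊞_ : ℝ → ℝ → ℝ
  _⊞_ = _+ℝ_

  _⊠_ : ℝ → ℝ → ℝ
  _⊠_ = _*ℝ_

  ⊟_ : ℝ → ℝ
  ⊟_ = -ℝ_

  seq-⊞ : ∀ x y n → seq (x ⊞ y) n ≡ seq x n ℚ.+ seq y n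
  seq-⊞ x y n = refl

  seq-⊠ : ∀ x y n → seq (x ⊠ y) n ≡ seq x n ℚ.* seq y n
  seq-⊠ x y n = refl

  seq-⊟ : ∀ x n → seq (⊟ x) n ≡ ℚ.- seq x n
  seq-⊟ x n = refl

  ⊞-cong : ∀ {x x′ y y′} → x ≃ x′ → y ≃ y′ → x ⊞ y ≃ x′ ⊞ y′
  ⊞-cong {x} {x′} {y} {y′} = +-cong {x} {x′} {y} {y′}

  ⊟-cong : ∀ {x y} → x ≃ y → ⊟ x ≃ ⊟ y
  ⊟-cong {x} {y} = -‿cong {x} {y}

  ⊠-congˡ : ∀ {x y y′} → y ≃ y′ → x ⊠ y ≃ x ⊠ y′
  ⊠-congˡ {x} {y} {y′} = *-congˡ {x} {y} {y′}

⊠-comm : ∀ x y → x ⊠ y ≃ y ⊠ x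
⊠-comm x y = pointwise λ n → trans (seq-⊠ x y n) (trans (ℚ.*-comm (seq x n) (seq y n)) (sym (seq-⊠ y x n)))

⊠-cong : ∀ {x x′ y y′} → x ≃ x′ → y ≃ y′ → x ⊠ y ≃ x′ ⊠ y′
⊠-cong {x} {x′} {y} {y′} x≃x′ y≃y′ =
  ≃-trans (⊠-congˡ y≃y′) (≃-trans (⊠-comm x y′) (≃-trans (⊠-congˡ x≃x′) (⊠-comm y′ x′)))

⊞-abelianGroup : AbelianGroup 0ℓ 0ℓ
⊞-abelianGroup = record
  { Carrier = ℝ
  ; _≈_     = _≃_
  ; _∙_     = _⊞_
  ; ε       = 0ℝ
  ; _⁻¹     = ⊟_
  ; isAbelianGroup = record
    { isGroup = record
      { isMonoid = record
        { isSemigroup = record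
          { isMagma = record
            { isEquivalence = record { refl = pointwise λ _ → refl ; sym = ≃-sym ; trans = ≃-trans }
            ; ∙-cong        = ⊞-cong
            }
          ; assoc = λ x y z → pointwise (assoc x y z)
          }
        ; identity = (λ x → pointwise λ n → trans (seq-⊞ 0ℝ x n) (ℚ.+-identityˡ (seq x n)))
                   , (λ x → pointwise λ n → trans (seq-⊞ x 0ℝ n) (ℚ.+-identityʳ (seq x n)))
        }
      ; inverse = (λ x → pointwise λ n → trans (seq-⊞ (⊟ x) x n)
                    (trans (cong (ℚ._+ seq x n) (seq-⊟ x n)) (ℚ.+-inverseˡ (seq x n))))
                , (λ x → pointwise λ n → trans (seq-⊞ x (⊟ x) n)
                    (trans (cong (seq x n ℚ.+_) (seq-⊟ x n)) (ℚ.+-inverseʳ (seq x n))))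
      ; ⁻¹-cong = ⊟-cong
      }
    ; comm = λ x y → pointwise λ n → trans (seq-⊞ x y n) (trans (ℚ.+-comm (seq x n) (seq y n)) (sym (seq-⊞ y x n)))
    }
  }
  where
  assoc : ∀ x y z n → seq (x ⊞ y ⊞ z) n ≡ seq (x ⊞ (y ⊞ z)) n
  assoc x y z n = begin
    seq (x ⊞ y ⊞ z) n                    ≡⟨ trans (seq-⊞ (x ⊞ y) z n) (cong (ℚ._+ seq z n) (seq-⊞ x y n)) ⟩
    seq x n ℚ.+ seq y n ℚ.+ seq z n      ≡⟨ ℚ.+-assoc (seq x n) (seq y n) (seq z n) ⟩
    seq x n ℚ.+ (seq y n ℚ.+ seq z n)    ≡⟨ trans (seq-⊞ x (y ⊞ z) n) (cong (seq x n ℚ.+_) (seq-⊞ y z n)) ⟨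
    seq (x ⊞ (y ⊞ z)) n                  ∎
    where open ≡-Reasoning

≃⇒≼ : ∀ {x y} → x ≃ y → x ≼ y
≃⇒≼ {x} {y} (approx x≈y) = bound λ ε 0<ε → (λ {n} ∣x-y∣<ε → subst (ℚ._< seq y n ℚ.+ ε) (lemma (seq x n) (seq y n))
    (ℚ.+-mono-≤-< (ℚ.≤-refl {seq y n}) (ℚ.≤-<-trans (p≤∣p∣ (seq x n ℚ.- seq y n)) ∣x-y∣<ε)))
  <$> x≈y ε 0<ε
  where
  open ℚ-Solver
  lemma : ∀ p q → q ℚ.+ (p ℚ.- q) ≡ p
  lemma = solve 2 (λ p q → q :+ (p :- q) := p) refl

≼-trans : ∀ {x y z} → x ≼ y → y ≼ z → x ≼ z
≼-trans {x} {y} {z} (bound x≤y) (bound y≤z) = bound λ ε 0<ε → (λ {n} x<y+ y<z+ → ℚ.<-trans x<y+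
    (subst (seq y n ℚ.+ ε ℚ.* ½ ℚ.<_) (trans (ℚ.+-assoc (seq z n) _ _) (cong (seq z n ℚ.+_) (½+½ ε)))
      (ℚ.+-monoˡ-< (ε ℚ.* ½) y<z+)))
  <$> x≤y _ (½>0 0<ε) <*> y≤z _ (½>0 0<ε)

opaque
  unfolding _⊞_

  ⊞-mono-≼ : ∀ {x x′ y y′} → x ≼ x′ → y ≼ y′ → x ⊞ y ≼ x′ ⊞ y′
  ⊞-mono-≼ {x} {x′} {y} {y′} (bound x≤x′) (bound y≤y′) = bound λ ε 0<ε → (λ {n} p< q< →
      subst (seq x n ℚ.+ seq y n ℚ.<_) (lemma (seq x′ n) (seq y′ n) ε) (ℚ.+-mono-< p< q<))
    <$> x≤x′ _ (½>0 0<ε) <*> y≤y′ _ (½>0 0<ε)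
    where
    open ℚ-Solver
    lemma : ∀ p q ε → (p ℚ.+ ε ℚ.* ½) ℚ.+ (q ℚ.+ ε ℚ.* ½) ≡ (p ℚ.+ q) ℚ.+ ε
    lemma p q ε = trans (solve 3 (λ p q h → (p :+ h) :+ (q :+ h) := (p :+ q) :+ (h :+ h)) refl p q (ε ℚ.* ½))
      (cong ((p ℚ.+ q) ℚ.+_) (½+½ ε))

<⇒≼ : ∀ {x y} → x <ℝ y → x ≼ y
<⇒≼ {x} {y} (δ , 0<δ , x+δ<y) = bound λ ε 0<ε → (λ {n} x+δ<y → ℚ.<-trans
    (subst (ℚ._< seq y n) (ℚ.+-identityʳ (seq x n)) (ℚ.<-trans (ℚ.+-monoʳ-< (seq x n) 0<δ) x+δ<y))
    (subst (ℚ._< seq y n ℚ.+ ε) (ℚ.+-identityʳ (seq y n)) (ℚ.+-monoʳ-< (seq y n) 0<ε)))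
  <$> x+δ<y

≼-antisym : ∀ {x y} → x ≼ y → y ≼ x → x ≃ y
≼-antisym {x} {y} (bound x≤y) (bound y≤x) = approx λ ε 0<ε →
  (λ {n} x<y+ε y<x+ε → lemma (seq x n) (seq y n) ε x<y+ε y<x+ε) <$> x≤y ε 0<ε <*> y≤x ε 0<ε
  where
  open ℚ-Solver
  difference : ∀ p q ε → p ℚ.< q ℚ.+ ε → p ℚ.- q ℚ.< ε
  difference p q ε p<q+ε = subst (p ℚ.- q ℚ.<_) (solve 2 (λ q ε → q :+ ε :- q := ε) refl q ε) (ℚ.+-monoˡ-< (ℚ.- q) p<q+ε)
  lemma : ∀ p q ε → p ℚ.< q ℚ.+ ε → q ℚ.< p ℚ.+ ε → ∣ p ℚ.- q ∣ ℚ.< ε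
  lemma p q ε p<q+ε q<p+ε with ℚ.∣p∣≡p∨∣p∣≡-p (p ℚ.- q)
  ... | inj₁ eq = subst (ℚ._< ε) (sym eq) (difference p q ε p<q+ε)
  ... | inj₂ eq = subst (ℚ._< ε) (sym (trans eq (solve 2 (λ p q → :- (p :- q) := q :- p) refl p q))) (difference q p ε q<p+ε)

-- Half of the margin of x above 0 survives in y, which eventually falls short of x by less than the
-- other half.
0<-resp-≃ : ∀ {x y} → x ≃ y → 0ℝ <ℝ x → 0ℝ <ℝ y
0<-resp-≃ {x} {y} (approx x≈y) (ε , 0<ε , ε<x) = ε ℚ.* ½ , ½>0 0<ε ,
  ((λ {n} ε<x ∣x-y∣<½ε → lemma (seq x n) (seq y n) ε<x (ℚ.≤-<-trans (p≤∣p∣ (seq x n ℚ.- seq y n)) ∣x-y∣<½ε))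
    <$> ε<x <*> x≈y (ε ℚ.* ½) (½>0 0<ε))
  where
  open ℚ-Solver
  lemma : ∀ p q → 0ℚ ℚ.+ ε ℚ.< p → p ℚ.- q ℚ.< ε ℚ.* ½ → 0ℚ ℚ.+ ε ℚ.* ½ ℚ.< q
  lemma p q ε<p p-q<½ε = subst₂ ℚ._<_
    (trans (cong (λ t → 0ℚ ℚ.+ t ℚ.- ε ℚ.* ½) (sym (½+½ ε)))
      (solve 1 (λ h → con 0ℚ :+ (h :+ h) :- h := con 0ℚ :+ h) refl (ε ℚ.* ½)))
    (solve 3 (λ p q h → p :- h :+ h :- p :+ q := q) refl p q (ε ℚ.* ½))
    (ℚ.<-trans (ℚ.+-monoˡ-< (ℚ.- (ε ℚ.* ½)) ε<p)
      (subst₂ ℚ._<_ (solve 3 (λ p q h → p :- q :+ (q :- h) := p :- h) refl p q (ε ℚ.* ½))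
        (solve 3 (λ p q h → h :+ (q :- h) := p :- h :+ h :- p :+ q) refl p q (ε ℚ.* ½))
        (ℚ.+-monoˡ-< (q ℚ.- ε ℚ.* ½) p-q<½ε)))

opaque
  unfolding _⊞_

  x⊞y⋠x : ∀ {x y} → 0ℝ <ℝ y → ¬ (x ⊞ y ≼ x)
  x⊞y⋠x {x} {y} (ε , 0<ε , ε<y) (bound x+y≤x) = extract
    ((λ {n} 0+ε<y x+y<x+ε → ℚ.<-asym (subst (ℚ._< seq y n) (ℚ.+-identityˡ ε) 0+ε<y)
        (subst₂ ℚ._<_ (lemma (seq x n) (seq y n)) (lemma (seq x n) ε) (ℚ.+-monoʳ-< (ℚ.- seq x n) x+y<x+ε)))
      <$> ε<y <*> x+y≤x ε 0<ε)
    where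
    open ℚ-Solver
    lemma : ∀ p q → ℚ.- p ℚ.+ (p ℚ.+ q) ≡ q
    lemma = solve 2 (λ p q → :- p :+ (p :+ q) := q) refl

opaque
  unfolding _⊠_

  multiple≄0 : ∀ {k x} → k ≢ 0ℚ → 0ℝ <ℝ x → ¬ (fromℚ k ⊠ x ≃ 0ℝ)
  multiple≄0 {k} {x} k≢0 (ε , 0<ε , ε<x) (approx kx≈0) = extract
    ((λ {n} 0+ε<x ∣kx∣< → ℚ.<-irrefl refl (ℚ.<-trans (lower n 0+ε<x) ∣kx∣<))
      <$> ε<x <*> kx≈0 (∣ k ∣ ℚ.* ε) 0<∣k∣ε)
    where
    instance
      ∣k∣>0 : ℚ.Positive ∣ k ∣
      ∣k∣>0 = ℚ.nonNeg∧nonZero⇒pos ∣ k ∣ {{ℚ.∣-∣-nonNeg k}} {{ℚ.≢-nonZero λ ∣k∣≡0 → k≢0 (ℚ.∣p∣≡0⇒p≡0 k ∣k∣≡0)}}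
    0<∣k∣ε : 0ℚ ℚ.< ∣ k ∣ ℚ.* ε
    0<∣k∣ε = subst (ℚ._< ∣ k ∣ ℚ.* ε) (ℚ.*-zeroʳ ∣ k ∣) (ℚ.*-monoʳ-<-pos ∣ k ∣ 0<ε)
    lower : ∀ n → 0ℚ ℚ.+ ε ℚ.< seq x n → ∣ k ∣ ℚ.* ε ℚ.< ∣ k ℚ.* seq x n ℚ.- 0ℚ ∣
    lower n 0+ε<x = subst (∣ k ∣ ℚ.* ε ℚ.<_)
      (trans (sym (ℚ.∣p*q∣≡∣p∣*∣q∣ k (seq x n))) (cong ∣_∣ (sym (ℚ.+-identityʳ (k ℚ.* seq x n)))))
      (ℚ.*-monoʳ-<-pos ∣ k ∣ (ℚ.<-≤-trans (subst (ℚ._< seq x n) (ℚ.+-identityˡ ε) 0+ε<x) (p≤∣p∣ (seq x n))))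

opaque
  unfolding _⊠_

  -- Eventually x y > ½ and y ≤ B, so x exceeds 1 / (2B): an explicit margin, obtained from an
  -- inverse instead of from x ≠ 0.
  x⊠y≃1⇒0<x : ∀ {x y} → (∀ n → 0ℚ ℚ.≤ seq x n) → x ⊠ y ≃ 1ℝ → 0ℝ <ℝ x
  x⊠y≃1⇒0<x {x} {y} 0≤x (approx xy≈1) =
    let B , 0<B , y≤B = eventually-bounded y
        C , 0<C , BC≡1 = reciprocal 0<B
    in ½ ℚ.* C , subst (ℚ._< ½ ℚ.* C) (ℚ.*-zeroʳ ½) (ℚ.*-monoʳ-<-pos ½ 0<C) ,
       ((λ {n} ∣y∣≤B ∣xy-1∣<½ → ℚ.*-cancelʳ-<-nonNeg B {{ℚ.nonNegative (ℚ.<⇒≤ 0<B)}}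
           (subst (ℚ._< seq x n ℚ.* B) (sym (½CB B C BC≡1))
             (ℚ.<-≤-trans (½<xy (seq x n ℚ.* seq y n) ∣xy-1∣<½)
               (ℚ.*-monoˡ-≤-nonNeg (seq x n) {{ℚ.nonNegative (0≤x n)}} (ℚ.≤-trans (p≤∣p∣ (seq y n)) ∣y∣≤B)))))
         <$> y≤B <*> xy≈1 ½ (ℚ.positive⁻¹ ½))
    where
    open ℚ-Solver
    ½CB : ∀ B C → B ℚ.* C ≡ 1ℚ → (0ℚ ℚ.+ ½ ℚ.* C) ℚ.* B ≡ ½
    ½CB B C BC≡1 = trans (solve 3 (λ h b c → (con 0ℚ :+ h :* c) :* b := h :* (b :* c)) refl ½ B C)
      (cong (½ ℚ.*_) BC≡1)
    ½<xy : ∀ t → ∣ t ℚ.- 1ℚ ∣ ℚ.< ½ → ½ ℚ.< t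
    ½<xy t h = subst₂ ℚ._<_ (solve 1 (λ t → t :- con ½ :+ (con 1ℚ :- t) := con ½) refl t)
      (solve 1 (λ t → t :- con ½ :+ con ½ := t) refl t)
      (ℚ.+-monoʳ-< (t ℚ.- ½) (ℚ.≤-<-trans (p≤∣p∣ (1ℚ ℚ.- t)) (subst (ℚ._< ½) (∣p-q∣≡∣q-p∣ t 1ℚ) h)))

-- Integers in ℚ

coprime-* : ∀ {m n o} → Coprime m n → Coprime m o → Coprime m (n ℕ.* o)
coprime-* m⊥n m⊥o (d∣m , d∣no) =
  m⊥o (d∣m , coprime-divisor (λ { (e∣d , e∣n) → m⊥n (ℕ.∣-trans e∣d d∣m , e∣n) }) d∣no)

coprime-^ : ∀ {m n} k → Coprime m n → Coprime (m ℕ.^ k) n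
coprime-^ zero    m⊥n (d∣1 , _) = Coprime.1-coprimeTo 1 (d∣1 , d∣1)
coprime-^ (suc k) m⊥n = Coprime.sym (coprime-* (Coprime.sym m⊥n) (Coprime.sym (coprime-^ k m⊥n)))

n<m^n : ∀ {m} → 2 ℕ.≤ m → ∀ n → n ℕ.< m ℕ.^ n
n<m^n 2≤m zero    = s≤s z≤n
n<m^n {m} 2≤m (suc n) = begin-strict
  suc n            ≤⟨ n<m^n 2≤m n ⟩
  m ℕ.^ n            <⟨ ℕ.m<m+n (m ℕ.^ n) (ℕ.≤-<-trans z≤n (n<m^n 2≤m n)) ⟩
  m ℕ.^ n ℕ.+ m ℕ.^ n  ≡⟨ cong (m ℕ.^ n ℕ.+_) (ℕ.+-identityʳ (m ℕ.^ n)) ⟨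
  2 ℕ.* m ℕ.^ n      ≤⟨ ℕ.*-monoˡ-≤ (m ℕ.^ n) 2≤m ⟩
  m ℕ.* m ℕ.^ n      ∎
  where open ℕ.≤-Reasoning

-- A geometric progression of naturals with ratio p/m, so that w 0 is divisible
-- by every power of m.
geometric : ∀ {m p} (w : ℕ → ℕ) → m ≢ 0 → Coprime m p → w 0 ≢ 0 →
  (∀ k → w (suc k) ℕ.* m ≡ w k ℕ.* p) → m ≡ 1
geometric {zero}        w m≢0 m⊥p w₀≢0 step = contradiction refl m≢0
geometric {suc zero}    w m≢0 m⊥p w₀≢0 step = refl
geometric {m@(suc (suc _))} {p} w m≢0 m⊥p w₀≢0 step =
  -- The power `m ^ w 0` divides `w 0` and yet exceeds it.
  contradiction (ℕ.<-≤-trans (n<m^n (s≤s (s≤s z≤n)) (w 0)) (ℕ.∣⇒≤ {{ℕ.≢-nonZero w₀≢0}} (power-divides (w 0) 0))) (ℕ.<-irrefl refl)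
  where
  power-divides : ∀ j k → m ℕ.^ j ℕ.∣ w k
  power-divides zero    k = ℕ.1∣ w k
  power-divides (suc j) k = coprime-divisor (coprime-^ (suc j) m⊥p)
    (subst₂ ℕ._∣_ (ℕ.*-comm (m ℕ.^ j) m) (trans (step k) (ℕ.*-comm (w k) p)) (ℕ.*-monoˡ-∣ m (power-divides j (suc k))))

κ : ℤ → ℚ
κ z = z ℚ./ 1

-- The fraction `z / 1` is normalised through a gcd and does not compute for a variable z, whereas
-- `fromℤ z` is a reduced fraction by construction.
κ≡fromℤ : ∀ z → κ z ≡ fromℤ z
κ≡fromℤ z = ℚ.↥p/↧p≡p (fromℤ z)

κ-+ : ∀ a b → κ (a ℤ.+ b) ≡ κ a ℚ.+ κ b
κ-+ a b = sym (trans (cong₂ ℚ._+_ (κ≡fromℤ a) (κ≡fromℤ b))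
  (cong κ (cong₂ ℤ._+_ (ℤ.*-identityʳ a) (ℤ.*-identityʳ b))))

κ-* : ∀ a b → κ (a ℤ.* b) ≡ κ a ℚ.* κ b
κ-* a b = sym (cong₂ ℚ._*_ (κ≡fromℤ a) (κ≡fromℤ b))

κ-neg : ∀ a → κ (ℤ.- a) ≡ ℚ.- κ a
κ-neg a = begin
  κ (ℤ.- a)                    ≡⟨ solve 2 (λ p q → p := (p :+ q) :- q) refl (κ (ℤ.- a)) (κ a) ⟩
  (κ (ℤ.- a) ℚ.+ κ a) ℚ.- κ a  ≡⟨ cong (ℚ._- κ a) (trans (sym (κ-+ (ℤ.- a) a)) (cong κ (ℤ.+-inverseˡ a))) ⟩
  0ℚ ℚ.- κ a                   ≡⟨ ℚ.+-identityˡ (ℚ.- κ a) ⟩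
  ℚ.- κ a                      ∎
  where
  open ≡-Reasoning
  open ℚ-Solver

κ-injective : ∀ {a b} → κ a ≡ κ b → a ≡ b
κ-injective {a} {b} eq = cong ↥_ (trans (sym (κ≡fromℤ a)) (trans eq (κ≡fromℤ b)))

κ-↧* : ∀ q → κ (↧ q) ℚ.* q ≡ κ (↥ q)
κ-↧* q@record{} = trans (cong (ℚ._* q) (κ≡fromℤ (↧ q))) (trans (ℚ.toℚᵘ-injective (ℚᵘ.≃-trans (ℚ.toℚᵘ-homo-* (fromℤ (↧ q)) q)
  (ℚᵘ.*≡* (solve 2 (λ a b → (b :* a) :* con 1ℤ := a :* (con 1ℤ :* b)) refl (↥ q) (↧ q))))) (sym (κ≡fromℤ (↥ q))))
  where open ℤ-Solver

IsInteger : ℚ → Set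
IsInteger q = ∃[ z ] q ≡ κ z

integer-+ : ∀ {p q} → IsInteger p → IsInteger q → IsInteger (p ℚ.+ q)
integer-+ (a , refl) (b , refl) = a ℤ.+ b , sym (κ-+ a b)

integer-* : ∀ {p q} → IsInteger p → IsInteger q → IsInteger (p ℚ.* q)
integer-* (a , refl) (b , refl) = a ℤ.* b , sym (κ-* a b)

integer-neg : ∀ {p} → IsInteger p → IsInteger (ℚ.- p)
integer-neg (a , refl) = ℤ.- a , sym (κ-neg a)

clear-denominator : ∀ q → ∃[ c ] IsInteger c × c ≢ 0ℚ × IsInteger (c ℚ.* q)
clear-denominator q = κ (↧ q) , (↧ q , refl) , (λ eq → ↧≢0 (κ-injective {↧ q} {0ℤ} eq)) , (↥ q , κ-↧* q)
  where
  ↧≢0 : ↧ q ≢ 0ℤ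
  ↧≢0 ()

coprime-↧↥ : ∀ q → Coprime (↧ₙ q) ℤ.∣ ↥ q ∣
coprime-↧↥ (mkℚ n d-1 coprime) = Coprime.sym (Coprime.recompute coprime)

↧≡1⇒integer : ∀ q → ↧ₙ q ≡ 1 → IsInteger q
↧≡1⇒integer (mkℚ n zero _) refl = n , sym (κ≡fromℤ n)

-- Here w k = E qᵏ. The absolute values of these integers form a geometric progression whose ratio
-- is ∣q∣ in lowest terms, so `geometric` forces the denominator of q to be 1.
bounded-powers⇒integer : ∀ {E q} (w : ℕ → ℚ) → E ≢ 0ℚ → w 0 ≡ E → (∀ k → w (suc k) ≡ w k ℚ.* q) →
  (∀ k → IsInteger (w k)) → IsInteger q
bounded-powers⇒integer {E} {q} w E≢0 w₀≡E step w-integer = ↧≡1⇒integer q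
  (geometric (λ k → ℤ.∣ v k ∣) (λ ()) (coprime-↧↥ q)
    (λ ∣v₀∣≡0 → E≢0 (trans (sym w₀≡E) (trans (proj₂ (w-integer 0)) (cong κ (ℤ.∣i∣≡0⇒i≡0 {v 0} ∣v₀∣≡0)))))
    (λ k → trans (sym (ℤ.abs-* (v (suc k)) (↧ q))) (trans (cong ℤ.∣_∣ (v-step k)) (ℤ.abs-* (v k) (↥ q)))))
  where
  v : ℕ → ℤ
  v k = proj₁ (w-integer k)
  v-step : ∀ k → v (suc k) ℤ.* ↧ q ≡ v k ℤ.* ↥ q
  v-step k = κ-injective (begin
    κ (v (suc k) ℤ.* ↧ q)      ≡⟨ κ-* (v (suc k)) (↧ q) ⟩
    κ (v (suc k)) ℚ.* κ (↧ q)  ≡⟨ cong (ℚ._* κ (↧ q)) (proj₂ (w-integer (suc k))) ⟨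
    w (suc k) ℚ.* κ (↧ q)      ≡⟨ cong (ℚ._* κ (↧ q)) (step k) ⟩
    w k ℚ.* q ℚ.* κ (↧ q)      ≡⟨ solve 3 (λ w q d → w :* q :* d := w :* (d :* q)) refl (w k) q (κ (↧ q)) ⟩
    w k ℚ.* (κ (↧ q) ℚ.* q)    ≡⟨ cong₂ ℚ._*_ (proj₂ (w-integer k)) (κ-↧* q) ⟩
    κ (v k) ℚ.* κ (↥ q)        ≡⟨ κ-* (v k) (↥ q) ⟨
    κ (v k ℤ.* ↥ q)            ∎)
    where
    open ≡-Reasoning
    open ℚ-Solver

-- For q = p / m in lowest terms, m² divides d p² and is coprime to p², so it divides d, and m = 1.
squarefree*square-integer : ∀ {d} → Squarefree d →
  ∀ q → IsInteger (κ (ℤ.+ d) ℚ.* (q ℚ.* q)) → IsInteger q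
squarefree*square-integer {d} squarefree q (z , dqq≡z) = ↧≡1⇒integer q
  (squarefree m (coprime-divisor (Coprime.sym (coprime-* p⊥m p⊥m) ) (ℕ.divides ℤ.∣ z ∣ pp*d≡z*mm)))
  where
  m = ↧ₙ q
  p = ℤ.∣ ↥ q ∣
  m⊥p = coprime-↧↥ q
  p⊥m : Coprime (p ℕ.* p) m
  p⊥m = Coprime.sym (coprime-* m⊥p m⊥p)
  integers : ℤ.+ d ℤ.* (↥ q ℤ.* ↥ q) ≡ z ℤ.* (↧ q ℤ.* ↧ q)
  integers = κ-injective (begin
    κ (ℤ.+ d ℤ.* (↥ q ℤ.* ↥ q))                        ≡⟨ trans (κ-* (ℤ.+ d) _) (cong (κ (ℤ.+ d) ℚ.*_) (κ-* (↥ q) (↥ q))) ⟩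
    κ (ℤ.+ d) ℚ.* (κ (↥ q) ℚ.* κ (↥ q))                ≡⟨ cong (λ t → κ (ℤ.+ d) ℚ.* (t ℚ.* t)) (κ-↧* q) ⟨
    κ (ℤ.+ d) ℚ.* (κ (↧ q) ℚ.* q ℚ.* (κ (↧ q) ℚ.* q))  ≡⟨ solve 3 (λ d m q →
      d :* (m :* q :* (m :* q)) := d :* (q :* q) :* (m :* m)) refl (κ (ℤ.+ d)) (κ (↧ q)) q ⟩
    κ (ℤ.+ d) ℚ.* (q ℚ.* q) ℚ.* (κ (↧ q) ℚ.* κ (↧ q))  ≡⟨ cong₂ ℚ._*_ dqq≡z (sym (κ-* (↧ q) (↧ q))) ⟩
    κ z ℚ.* κ (↧ q ℤ.* ↧ q)                            ≡⟨ κ-* z _ ⟨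
    κ (z ℤ.* (↧ q ℤ.* ↧ q))                            ∎)
    where
    open ≡-Reasoning
    open ℚ-Solver
  pp*d≡z*mm : p ℕ.* p ℕ.* d ≡ ℤ.∣ z ∣ ℕ.* (m ℕ.* m)
  pp*d≡z*mm = begin
    p ℕ.* p ℕ.* d                      ≡⟨ ℕ.*-comm (p ℕ.* p) d ⟩
    d ℕ.* (p ℕ.* p)                    ≡⟨ cong (d ℕ.*_) (ℤ.abs-* (↥ q) (↥ q)) ⟨
    d ℕ.* ℤ.∣ ↥ q ℤ.* ↥ q ∣            ≡⟨ ℤ.abs-* (ℤ.+ d) (↥ q ℤ.* ↥ q) ⟨
    ℤ.∣ ℤ.+ d ℤ.* (↥ q ℤ.* ↥ q) ∣      ≡⟨ cong ℤ.∣_∣ integers ⟩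
    ℤ.∣ z ℤ.* (↧ q ℤ.* ↧ q) ∣          ≡⟨ ℤ.abs-* z (↧ q ℤ.* ↧ q) ⟩
    ℤ.∣ z ∣ ℕ.* ℤ.∣ ↧ q ℤ.* ↧ q ∣      ≡⟨ cong (ℤ.∣ z ∣ ℕ.*_) (ℤ.abs-* (↧ q) (↧ q)) ⟩
    ℤ.∣ z ∣ ℕ.* (m ℕ.* m)              ∎
    where open ≡-Reasoning

half-integral-norm : ∀ D T Y N p q → p ℚ.+ p ≡ κ T → q ℚ.+ q ≡ κ Y →
  p ℚ.* p ℚ.+ κ D ℚ.* (q ℚ.* q) ≡ κ N → T ℤ.* T ℤ.+ D ℤ.* (Y ℤ.* Y) ≡ ℤ.+ 4 ℤ.* N
half-integral-norm D T Y N p q 2p≡T 2q≡Y norm≡N = κ-injective {T ℤ.* T ℤ.+ D ℤ.* (Y ℤ.* Y)} {ℤ.+ 4 ℤ.* N} (begin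
  κ (T ℤ.* T ℤ.+ D ℤ.* (Y ℤ.* Y))
    ≡⟨ κ-+ (T ℤ.* T) (D ℤ.* (Y ℤ.* Y)) ⟩
  κ (T ℤ.* T) ℚ.+ κ (D ℤ.* (Y ℤ.* Y))
    ≡⟨ cong₂ ℚ._+_ (κ-* T T) (trans (κ-* D (Y ℤ.* Y)) (cong (κ D ℚ.*_) (κ-* Y Y))) ⟩
  κ T ℚ.* κ T ℚ.+ κ D ℚ.* (κ Y ℚ.* κ Y)
    ≡⟨ cong₂ (λ s t → s ℚ.* s ℚ.+ κ D ℚ.* (t ℚ.* t)) 2p≡T 2q≡Y ⟨
  (p ℚ.+ p) ℚ.* (p ℚ.+ p) ℚ.+ κ D ℚ.* ((q ℚ.+ q) ℚ.* (q ℚ.+ q))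
    ≡⟨ expand (κ D) ⟩
  κ (ℤ.+ 4) ℚ.* (p ℚ.* p ℚ.+ κ D ℚ.* (q ℚ.* q))
    ≡⟨ cong (κ (ℤ.+ 4) ℚ.*_) norm≡N ⟩
  κ (ℤ.+ 4) ℚ.* κ N
    ≡⟨ κ-* (ℤ.+ 4) N ⟨
  κ (ℤ.+ 4 ℤ.* N) ∎)
  where
  open ≡-Reasoning
  open ℚ-Solver
  expand : ∀ D → (p ℚ.+ p) ℚ.* (p ℚ.+ p) ℚ.+ D ℚ.* ((q ℚ.+ q) ℚ.* (q ℚ.+ q)) ≡ κ (ℤ.+ 4) ℚ.* (p ℚ.* p ℚ.+ D ℚ.* (q ℚ.* q))
  expand D = solve 3 (λ D p q → (p :+ p) :* (p :+ p) :+ D :* ((q :+ q) :* (q :+ q)) := con (κ (ℤ.+ 4)) :* (p :* p :+ D :* (q :* q))) refl D p q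

bit : Bool → ℤ
bit false = 0ℤ
bit true  = 1ℤ

parity : ∀ z → ∃[ b ] ∃[ h ] z ≡ bit b ℤ.+ (h ℤ.+ h)
parity z = go (z ℤ.%ℕ 2) (ℤ.n%ℕd<d z 2) (ℤ.a≡a%ℕn+[a/ℕn]*n z 2)
  where
  open ℤ-Solver
  h = z ℤ./ℕ 2
  double : ∀ c → c ℤ.+ h ℤ.* ℤ.+ 2 ≡ c ℤ.+ (h ℤ.+ h)
  double c = solve 2 (λ c h → c :+ h :* con (ℤ.+ 2) := c :+ (h :+ h)) refl c h
  go : ∀ r → r ℕ.< 2 → z ≡ ℤ.+ r ℤ.+ h ℤ.* ℤ.+ 2 → ∃[ b ] ∃[ h ] z ≡ bit b ℤ.+ (h ℤ.+ h)
  go 0 _ eq = false , h , trans eq (double 0ℤ)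
  go 1 _ eq = true  , h , trans eq (double 1ℤ)
  go (suc (suc r)) (s≤s (s≤s ())) eq

-- The ring of integers of ℚ(√-d)

p*q≢0 : ∀ {p q} → p ≢ 0ℚ → q ≢ 0ℚ → p ℚ.* q ≢ 0ℚ
p*q≢0 {p} {q} p≢0 q≢0 pq≡0 = q≢0 (begin
  q                     ≡⟨ ℚ.*-identityˡ q ⟨
  1ℚ ℚ.* q              ≡⟨ cong (ℚ._* q) (ℚ.*-inverseˡ p) ⟨
  ℚ.1/ p ℚ.* p ℚ.* q    ≡⟨ ℚ.*-assoc (ℚ.1/ p) p q ⟩
  ℚ.1/ p ℚ.* (p ℚ.* q)  ≡⟨ cong (ℚ.1/ p ℚ.*_) pq≡0 ⟩
  ℚ.1/ p ℚ.* 0ℚ         ≡⟨ ℚ.*-zeroʳ (ℚ.1/ p) ⟩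
  0ℚ                    ∎)
  where
  open ≡-Reasoning
  instance p-nonZero = ℚ.≢-nonZero p≢0

module Quadratic (d : ℕ) where

  private
    D : ℚ
    D = κ (ℤ.+ d)
    module Raw = RawRing (ℚ√-rawRing d)
    open ℚ-Solver

  commutativeRing : CommutativeRing 0ℓ 0ℓ
  commutativeRing = record
    { RawRing (ℚ√-rawRing d)
    ; isCommutativeRing = record
      { isRing = record
        { +-isAbelianGroup = record
          { isGroup = record
            { isMonoid = record
              { isSemigroup = record
                { isMagma = record { isEquivalence = isEquivalence ; ∙-cong = cong₂ Raw._+_ }
                ; assoc = λ x y z → cong₂ _+√_ (ℚ.+-assoc (rat x) (rat y) (rat z)) (ℚ.+-assoc (irr x) (irr y) (irr z))
                }
              ; identity = (λ x → cong₂ _+√_ (ℚ.+-identityˡ (rat x)) (ℚ.+-identityˡ (irr x)))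
                         , (λ x → cong₂ _+√_ (ℚ.+-identityʳ (rat x)) (ℚ.+-identityʳ (irr x)))
              }
            ; inverse = (λ x → cong₂ _+√_ (ℚ.+-inverseˡ (rat x)) (ℚ.+-inverseˡ (irr x)))
                      , (λ x → cong₂ _+√_ (ℚ.+-inverseʳ (rat x)) (ℚ.+-inverseʳ (irr x)))
            ; ⁻¹-cong = cong Raw.-_
            }
          ; comm = λ x y → cong₂ _+√_ (ℚ.+-comm (rat x) (rat y)) (ℚ.+-comm (irr x) (irr y))
          }
        ; *-cong     = cong₂ Raw._*_
        ; *-assoc    = λ { (p +√ q) (r +√ s) (t +√ u) → cong₂ _+√_
            (solve 7 (λ D p q r s t u → (p :* r :- D :* (q :* s)) :* t :- D :* ((p :* s :+ q :* r) :* u)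
               := p :* (r :* t :- D :* (s :* u)) :- D :* (q :* (r :* u :+ s :* t))) refl D p q r s t u)
            (solve 7 (λ D p q r s t u → (p :* r :- D :* (q :* s)) :* u :+ (p :* s :+ q :* r) :* t
               := p :* (r :* u :+ s :* t) :+ q :* (r :* t :- D :* (s :* u))) refl D p q r s t u) }
        ; *-identity = (λ x → trans (*-comm Raw.1# x) (*-identityʳ x)) , *-identityʳ
        ; distrib    = *-distribˡ , λ x y z → trans (*-comm (y Raw.+ z) x)
                         (trans (*-distribˡ x y z) (cong₂ Raw._+_ (*-comm x y) (*-comm x z)))
        }
      ; *-comm = *-comm
      }
    }
    where
    *-comm : ∀ x y → x Raw.* y ≡ y Raw.* x
    *-comm (p +√ q) (r +√ s) = cong₂ _+√_
      (solve 5 (λ D p q r s → p :* r :- D :* (q :* s) := r :* p :- D :* (s :* q)) refl D p q r s)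
      (solve 4 (λ p q r s → p :* s :+ q :* r := r :* q :+ s :* p) refl p q r s)
    *-identityʳ : ∀ x → x Raw.* Raw.1# ≡ x
    *-identityʳ (p +√ q) = cong₂ _+√_
      (solve 3 (λ D p q → p :* con 1ℚ :- D :* (q :* con 0ℚ) := p) refl D p q)
      (solve 2 (λ p q → p :* con 0ℚ :+ q :* con 1ℚ := q) refl p q)
    *-distribˡ : ∀ x y z → x Raw.* (y Raw.+ z) ≡ x Raw.* y Raw.+ x Raw.* z
    *-distribˡ (p +√ q) (r +√ s) (t +√ u) = cong₂ _+√_
      (solve 7 (λ D p q r s t u → p :* (r :+ t) :- D :* (q :* (s :+ u))
         := (p :* r :- D :* (q :* s)) :+ (p :* t :- D :* (q :* u))) refl D p q r s t u)
      (solve 6 (λ p q r s t u → p :* (s :+ u) :+ q :* (r :+ t) := (p :* s :+ q :* r) :+ (p :* u :+ q :* t)) refl p q r s t u)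

  open CommutativeRing commutativeRing using (_+_; _*_; -_; 1#; *-identityʳ)

  norm : ℚ√- d → ℚ
  norm x = rat x ℚ.* rat x ℚ.+ D ℚ.* (irr x ℚ.* irr x)

  norm-* : ∀ x y → norm (x * y) ≡ norm x ℚ.* norm y
  norm-* (p +√ q) (r +√ s) = solve 5 (λ D p q r s →
    (p :* r :- D :* (q :* s)) :* (p :* r :- D :* (q :* s)) :+ D :* ((p :* s :+ q :* r) :* (p :* s :+ q :* r))
    := (p :* p :+ D :* (q :* q)) :* (r :* r :+ D :* (s :* s))) refl D p q r s

  norm-rational≢0 : ∀ {p} → p ≢ 0ℚ → norm (p +√ 0ℚ) ≢ 0ℚ
  norm-rational≢0 {p} p≢0 eq = p*q≢0 p≢0 p≢0
    (trans (sym (ℚ.+-identityʳ (p ℚ.* p))) (trans (cong (p ℚ.* p ℚ.+_) (sym (ℚ.*-zeroʳ D))) eq))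

  -- Membership in the order ℤ[√-d], which has index 1 or 2 in the ring of integers when d is
  -- squarefree.
  record IsOrder (x : ℚ√- d) : Set where
    constructor order
    field
      rat-integer : IsInteger (rat x)
      irr-integer : IsInteger (irr x)

  order-+ : ∀ {x y} → IsOrder x → IsOrder y → IsOrder (x + y)
  order-+ (order p q) (order r s) = order (integer-+ p r) (integer-+ q s)

  order-* : ∀ {x y} → IsOrder x → IsOrder y → IsOrder (x * y)
  order-* (order p q) (order r s) = order
    (integer-+ (integer-* p r) (integer-neg (integer-* (ℤ.+ d , refl) (integer-* q s))))
    (integer-+ (integer-* p s) (integer-* q r))

  order-neg : ∀ {x} → IsOrder x → IsOrder (- x)
  order-neg (order p q) = order (integer-neg p) (integer-neg q)

  norm-order : ∀ {x} → IsOrder x → IsInteger (norm x)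
  norm-order (order p q) = integer-+ (integer-* p p) (integer-* (ℤ.+ d , refl) (integer-* q q))

  order-scalar : ∀ c → IsOrder (κ c +√ 0ℚ)
  order-scalar c = order (c , refl) (0ℤ , refl)

  clear-denominators : ∀ x → ∃[ c ] IsOrder c × norm c ≢ 0ℚ × IsOrder (c * x)
  clear-denominators (p +√ q) with clear-denominator p | clear-denominator q
  ... | a , a-integer , a≢0 , ap-integer | b , b-integer , b≢0 , bq-integer =
    (a ℚ.* b) +√ 0ℚ , order (integer-* a-integer b-integer) (0ℤ , refl) ,
    norm-rational≢0 (p*q≢0 a≢0 b≢0) ,
    order
      (subst IsInteger (solve 5 (λ D a b p q → b :* (a :* p) := a :* b :* p :- D :* (con 0ℚ :* q)) refl D a b p q)
        (integer-* b-integer ap-integer))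
      (subst IsInteger (solve 4 (λ a b p q → a :* (b :* q) := a :* b :* q :+ con 0ℚ :* p) refl a b p q)
        (integer-* a-integer bq-integer))
  norm-1≢0 : norm 1# ≢ 0ℚ
  norm-1≢0 = norm-rational≢0 {1ℚ} λ ()

  norm-*≢0 : ∀ x y → norm x ≢ 0ℚ → norm y ≢ 0ℚ → norm (x * y) ≢ 0ℚ
  norm-*≢0 x y x≢0 y≢0 eq = p*q≢0 x≢0 y≢0 (trans (sym (norm-* x y)) eq)

  open CommonDenominators commutativeRing IsOrder (subst IsOrder) order-+ order-* order-neg
    (order-scalar 0ℤ) (order-scalar 1ℤ) (λ c → norm c ≢ 0ℚ) norm-*≢0 norm-1≢0 clear-denominators

  scalar : ℤ → ℚ√- d
  scalar c = κ c +√ 0ℚ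

  evalMonic-scalar : ∀ cs x → evalMonicAt (map scalar cs) x ≡ evalMonic cs x
  evalMonic-scalar []       x = refl
  evalMonic-scalar (c ∷ cs) x = cong (λ t → scalar c + x * t) (evalMonic-scalar cs x)

  integral⇒almostIntegral : ∀ {x} → IsIntegral x → AlmostIntegral x
  integral⇒almostIntegral {x} (cs , root) =
    root⇒almostIntegral (map⁺ (universal order-scalar cs)) (trans (evalMonic-scalar cs x) root)

  -- The norms N(c xᵏ) = N(c) N(x)ᵏ are all integers, so the denominators of the powers of N(x) stay
  -- bounded.
  norm-integer : ∀ {x} → AlmostIntegral x → IsInteger (norm x)
  norm-integer {x} (c , c≢0 , cxᵏ-order) = bounded-powers⇒integer (λ k → norm (c * x ^ k)) c≢0
    (cong norm (*-identityʳ c))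
    (λ k → trans (cong norm (*^-suc c x k)) (norm-* (c * x ^ k) x))
    (λ k → norm-order (cxᵏ-order k))

  -- The trace is N(x + 1) - N(x) - 1, and x + 1 is almost integral along with x.
  trace-integer : ∀ {x} → IsIntegral x → IsInteger (rat x ℚ.+ rat x)
  trace-integer {x} x-integral = subst IsInteger
    (solve 3 (λ D p q → (p :+ con 1ℚ) :* (p :+ con 1ℚ) :+ D :* ((q :+ con 0ℚ) :* (q :+ con 0ℚ)) :+ :- (p :* p :+ D :* (q :* q)) :+ :- con 1ℚ
       := p :+ p) refl D (rat x) (irr x))
    (integer-+ (integer-+ (norm-integer (almostIntegral-suc x-almost)) (integer-neg (norm-integer x-almost))) (integer-neg (1ℤ , refl)))
    where x-almost = integral⇒almostIntegral x-integral

  -- For x = p + q √-d, the number d (2q)² = 4 N(x) - (2p)² is an integer.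
  double-irr-integer : Squarefree d → ∀ {x} → IsIntegral x → IsInteger (irr x ℚ.+ irr x)
  double-irr-integer squarefree {x} x-integral = squarefree*square-integer squarefree (irr x ℚ.+ irr x)
    (subst IsInteger
      (solve 3 (λ D p q → con (κ (ℤ.+ 4)) :* (p :* p :+ D :* (q :* q)) :+ :- ((p :+ p) :* (p :+ p)) := D :* ((q :+ q) :* (q :+ q))) refl
        D (rat x) (irr x))
      (integer-+ (integer-* (ℤ.+ 4 , refl) (norm-integer (integral⇒almostIntegral x-integral)))
        (integer-neg (integer-* (trace-integer x-integral) (trace-integer x-integral)))))

  -- x = (T + Y √-d) / 2 has trace T and norm N.
  record HalfIntegral (x : ℚ√- d) : Set where
    constructor halves
    field
      {T Y N} : ℤ
      rat≡  : rat x ≡ κ T ℚ.* ½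
      irr≡  : irr x ≡ κ Y ℚ.* ½
      norm≡ : T ℤ.* T ℤ.+ ℤ.+ d ℤ.* (Y ℤ.* Y) ≡ ℤ.+ 4 ℤ.* N

  integral⇒halfIntegral : Squarefree d → ∀ {x} → IsIntegral x → HalfIntegral x
  integral⇒halfIntegral squarefree {x} x-integral = go
    (trace-integer x-integral) (double-irr-integer squarefree x-integral) (norm-integer (integral⇒almostIntegral x-integral))
    where
    half : ∀ p → p ≡ (p ℚ.+ p) ℚ.* ½
    half = solve 1 (λ p → p := (p :+ p) :* con ½) refl
    go : IsInteger (rat x ℚ.+ rat x) → IsInteger (irr x ℚ.+ irr x) → IsInteger (norm x) → HalfIntegral x
    go (T , 2p≡T) (Y , 2q≡Y) (N , norm≡N) = halves {T = T} {Y} {N}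
      (trans (half (rat x)) (cong (ℚ._* ½) 2p≡T)) (trans (half (irr x)) (cong (ℚ._* ½) 2q≡Y))
      (half-integral-norm (ℤ.+ d) T Y N (rat x) (irr x) 2p≡T 2q≡Y norm≡N)

-- The ring of integers is ℤ + ℤω with ω = p + h √-d a root of X² - τ X + ν.
record IntegralBasis (d : ℕ) : Set where
  field
    τ ν   : ℤ
    p h   : ℚ
    τ≡    : κ τ ≡ p ℚ.+ p
    ν≡    : κ ν ≡ p ℚ.* p ℚ.+ κ (ℤ.+ d) ℚ.* (h ℚ.* h)
    h≢0   : h ≢ 0ℚ

  element : ℤ → ℤ → ℚ√- d
  element a b = (κ a ℚ.+ κ b ℚ.* p) +√ (κ b ℚ.* h)

  field
    spans : ∀ {x} → IsIntegral x → ∃[ a ] ∃[ b ] x ≡ element a b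

  open RawRing (ℚ√-rawRing d) using (_+_; -_; 0#)

  element-+ : ∀ a b a′ b′ → element (a ℤ.+ a′) (b ℤ.+ b′) ≡ element a b + element a′ b′
  element-+ a b a′ b′ = cong₂ _+√_
    (trans (cong₂ (λ s t → s ℚ.+ t ℚ.* p) (κ-+ a a′) (κ-+ b b′))
      (solve 5 (λ a b a′ b′ p → (a :+ a′) :+ (b :+ b′) :* p := (a :+ b :* p) :+ (a′ :+ b′ :* p)) refl
        (κ a) (κ b) (κ a′) (κ b′) p))
    (trans (cong (ℚ._* h) (κ-+ b b′)) (ℚ.*-distribʳ-+ h (κ b) (κ b′)))
    where open ℚ-Solver

  element-neg : ∀ a b → element (ℤ.- a) (ℤ.- b) ≡ - element a b
  element-neg a b = cong₂ _+√_
    (trans (cong₂ (λ s t → s ℚ.+ t ℚ.* p) (κ-neg a) (κ-neg b))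
      (solve 3 (λ a b p → :- a :+ :- b :* p := :- (a :+ b :* p)) refl (κ a) (κ b) p))
    (trans (cong (ℚ._* h) (κ-neg b)) (solve 2 (λ b h → :- b :* h := :- (b :* h)) refl (κ b) h))
    where open ℚ-Solver

  element-injective₀ : ∀ {a b} → element a b ≡ 0# → a ≡ 0ℤ × b ≡ 0ℤ
  element-injective₀ {a} {b} eq = κ-injective (begin
      κ a                 ≡⟨ ℚ.+-identityʳ (κ a) ⟨
      κ a ℚ.+ 0ℚ          ≡⟨ cong (κ a ℚ.+_) (ℚ.*-zeroˡ p) ⟨
      κ a ℚ.+ 0ℚ ℚ.* p    ≡⟨ cong (λ t → κ a ℚ.+ κ t ℚ.* p) b≡0 ⟨
      κ a ℚ.+ κ b ℚ.* p   ≡⟨ cong rat eq ⟩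
      κ 0ℤ                ∎) , b≡0
    where
    open ≡-Reasoning
    b≡0 : b ≡ 0ℤ
    b≡0 with b ℤ.≟ 0ℤ
    ... | yes b≡0 = b≡0
    ... | no  b≢0 = contradiction (cong irr eq) (p*q≢0 (λ κb≡0 → b≢0 (κ-injective {b} {0ℤ} κb≡0)) h≢0)

  -- The element a + bω is a root of X² - tX + n, where t is its trace and n its norm.
  element-integral : ∀ a b → IsIntegral (element a b)
  element-integral a b = n ∷ ℤ.- t ∷ [] , root (κ (ℤ.+ d)) κn κt
    where
    t n : ℤ
    t = a ℤ.+ a ℤ.+ b ℤ.* τ
    n = a ℤ.* a ℤ.+ a ℤ.* b ℤ.* τ ℤ.+ b ℤ.* b ℤ.* ν
    κt : κ (ℤ.- t) ≡ ℚ.- (κ a ℚ.+ κ a ℚ.+ κ b ℚ.* (p ℚ.+ p))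
    κt = trans (κ-neg t) (cong ℚ.-_ (trans (κ-+ (a ℤ.+ a) (b ℤ.* τ))
      (cong₂ ℚ._+_ (κ-+ a a) (trans (κ-* b τ) (cong (κ b ℚ.*_) τ≡)))))
    κn : κ n ≡ κ a ℚ.* κ a ℚ.+ κ a ℚ.* κ b ℚ.* (p ℚ.+ p) ℚ.+ κ b ℚ.* κ b ℚ.* (p ℚ.* p ℚ.+ κ (ℤ.+ d) ℚ.* (h ℚ.* h))
    κn = trans (κ-+ (a ℤ.* a ℤ.+ a ℤ.* b ℤ.* τ) (b ℤ.* b ℤ.* ν)) (cong₂ ℚ._+_
      (trans (κ-+ (a ℤ.* a) (a ℤ.* b ℤ.* τ)) (cong₂ ℚ._+_ (κ-* a a)
        (trans (κ-* (a ℤ.* b) τ) (cong₂ ℚ._*_ (κ-* a b) τ≡))))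
      (trans (κ-* (b ℤ.* b) ν) (cong₂ ℚ._*_ (κ-* b b) ν≡)))
    open ℚ-Solver
    -- This is `evalMonic` unfolded into its two coordinates. The coefficients are variables, so
    -- that the equations for them can be matched with `refl` before the ring solver runs.
    root : ∀ {n t} D →
      n ≡ κ a ℚ.* κ a ℚ.+ κ a ℚ.* κ b ℚ.* (p ℚ.+ p) ℚ.+ κ b ℚ.* κ b ℚ.* (p ℚ.* p ℚ.+ D ℚ.* (h ℚ.* h)) →
      t ≡ ℚ.- (κ a ℚ.+ κ a ℚ.+ κ b ℚ.* (p ℚ.+ p)) →
      let X = κ a ℚ.+ κ b ℚ.* p ; Y = κ b ℚ.* h
          U = t ℚ.+ (X ℚ.* 1ℚ ℚ.- D ℚ.* (Y ℚ.* 0ℚ)) ; V = 0ℚ ℚ.+ (X ℚ.* 0ℚ ℚ.+ Y ℚ.* 1ℚ) in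
      _≡_ {A = ℚ√- d} ((n ℚ.+ (X ℚ.* U ℚ.- D ℚ.* (Y ℚ.* V))) +√ (0ℚ ℚ.+ (X ℚ.* V ℚ.+ Y ℚ.* U))) (0ℚ +√ 0ℚ)
    root D refl refl = cong₂ _+√_
      (solve 5 (λ D a b p h →
        let X = a :+ b :* p ; Y = b :* h
            N = a :* a :+ a :* b :* (p :+ p) :+ b :* b :* (p :* p :+ D :* (h :* h))
            T = :- (a :+ a :+ b :* (p :+ p))
            U = T :+ (X :* con 1ℚ :- D :* (Y :* con 0ℚ)) ; V = con 0ℚ :+ (X :* con 0ℚ :+ Y :* con 1ℚ) in
        N :+ (X :* U :- D :* (Y :* V)) := con 0ℚ) refl D (κ a) (κ b) p h)
      (solve 5 (λ D a b p h →
        let X = a :+ b :* p ; Y = b :* h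
            T = :- (a :+ a :+ b :* (p :+ p))
            U = T :+ (X :* con 1ℚ :- D :* (Y :* con 0ℚ)) ; V = con 0ℚ :+ (X :* con 0ℚ :+ Y :* con 1ℚ) in
        con 0ℚ :+ (X :* V :+ Y :* U) := con 0ℚ) refl D (κ a) (κ b) p h)

-- The equation T² + d Y² = 4N modulo 4, and the integral basis

not-multiple-of-4 : ∀ n {_ : False (4 ℕ.∣? n)} W → ℤ.+ n ≢ ℤ.+ 4 ℤ.* W
not-multiple-of-4 n {4∤n} W n≡4W = toWitnessFalse 4∤n
  (ℕ.divides ℤ.∣ W ∣ (trans (cong ℤ.∣_∣ n≡4W) (trans (ℤ.abs-* (ℤ.+ 4) W) (ℕ.*-comm 4 ℤ.∣ W ∣))))

-- Squares modulo 4 depend only on parity, so T, Y and D may be replaced by their residues t, y and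
-- e. The difference of the two sides is 4Z.
residue : ∀ (e t y k h g N D : ℤ) → D ≡ e ℤ.+ k ℤ.* ℤ.+ 4 →
  (t ℤ.+ (h ℤ.+ h)) ℤ.* (t ℤ.+ (h ℤ.+ h)) ℤ.+ D ℤ.* ((y ℤ.+ (g ℤ.+ g)) ℤ.* (y ℤ.+ (g ℤ.+ g))) ≡ ℤ.+ 4 ℤ.* N →
  ∃[ W ] t ℤ.* t ℤ.+ e ℤ.* (y ℤ.* y) ≡ ℤ.+ 4 ℤ.* W
residue e t y k h g N _ refl eq = N ℤ.- Z , (begin
  t ℤ.* t ℤ.+ e ℤ.* (y ℤ.* y)         ≡⟨ solve 6 (λ e t y k h g →
      t :* t :+ e :* (y :* y) := (t :+ (h :+ h)) :* (t :+ (h :+ h)) :+ (e :+ k :* con (ℤ.+ 4)) :* ((y :+ (g :+ g)) :* (y :+ (g :+ g)))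
        :- con (ℤ.+ 4) :* ((t :* h :+ h :* h) :+ e :* (y :* g :+ g :* g) :+ k :* ((y :+ (g :+ g)) :* (y :+ (g :+ g))))) refl e t y k h g ⟩
  X ℤ.- ℤ.+ 4 ℤ.* Z                   ≡⟨ cong (ℤ._- ℤ.+ 4 ℤ.* Z) eq ⟩
  ℤ.+ 4 ℤ.* N ℤ.- ℤ.+ 4 ℤ.* Z         ≡⟨ solve 2 (λ N Z → con (ℤ.+ 4) :* N :- con (ℤ.+ 4) :* Z := con (ℤ.+ 4) :* (N :- Z)) refl N Z ⟩
  ℤ.+ 4 ℤ.* (N ℤ.- Z)                 ∎)
  where
  open ≡-Reasoning
  open ℤ-Solver
  X = (t ℤ.+ (h ℤ.+ h)) ℤ.* (t ℤ.+ (h ℤ.+ h)) ℤ.+ (e ℤ.+ k ℤ.* ℤ.+ 4) ℤ.* ((y ℤ.+ (g ℤ.+ g)) ℤ.* (y ℤ.+ (g ℤ.+ g)))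
  Z = (t ℤ.* h ℤ.+ h ℤ.* h) ℤ.+ e ℤ.* (y ℤ.* g ℤ.+ g ℤ.* g) ℤ.+ k ℤ.* ((y ℤ.+ (g ℤ.+ g)) ℤ.* (y ℤ.+ (g ℤ.+ g)))

residue₁ : ∀ t y W → bit t ℤ.* bit t ℤ.+ ℤ.+ 1 ℤ.* (bit y ℤ.* bit y) ≡ ℤ.+ 4 ℤ.* W → t ≡ false × y ≡ false
residue₁ false false W eq = refl , refl
residue₁ false true  W eq = contradiction eq (not-multiple-of-4 1 W)
residue₁ true  false W eq = contradiction eq (not-multiple-of-4 1 W)
residue₁ true  true  W eq = contradiction eq (not-multiple-of-4 2 W)

residue₂ : ∀ t y W → bit t ℤ.* bit t ℤ.+ ℤ.+ 2 ℤ.* (bit y ℤ.* bit y) ≡ ℤ.+ 4 ℤ.* W → t ≡ false × y ≡ false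
residue₂ false false W eq = refl , refl
residue₂ false true  W eq = contradiction eq (not-multiple-of-4 2 W)
residue₂ true  false W eq = contradiction eq (not-multiple-of-4 1 W)
residue₂ true  true  W eq = contradiction eq (not-multiple-of-4 3 W)

residue₃ : ∀ t y W → bit t ℤ.* bit t ℤ.+ ℤ.+ 3 ℤ.* (bit y ℤ.* bit y) ≡ ℤ.+ 4 ℤ.* W → t ≡ y
residue₃ false false W eq = refl
residue₃ false true  W eq = contradiction eq (not-multiple-of-4 3 W)
residue₃ true  false W eq = contradiction eq (not-multiple-of-4 1 W)
residue₃ true  true  W eq = refl

module _ {d : ℕ} (squarefree : Squarefree d) where

  open Quadratic d

  -- The case d ≡ 1 or 2 modulo 4, where T and Y are both even and ω = √-d.
  basis-√-d : (∀ T Y N → T ℤ.* T ℤ.+ ℤ.+ d ℤ.* (Y ℤ.* Y) ≡ ℤ.+ 4 ℤ.* N →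
    (∃[ h ] T ≡ h ℤ.+ h) × (∃[ g ] Y ≡ g ℤ.+ g)) → IntegralBasis d
  basis-√-d even = record
    { τ = 0ℤ ; ν = ℤ.+ d ; p = 0ℚ ; h = 1ℚ ; τ≡ = refl
    ; ν≡ = sym (trans (ℚ.+-identityˡ (κ (ℤ.+ d) ℚ.* 1ℚ)) (ℚ.*-identityʳ (κ (ℤ.+ d))))
    ; h≢0 = λ ()
    ; spans = λ x-integral → go (integral⇒halfIntegral squarefree x-integral)
    }
    where
    open ℚ-Solver
    go : ∀ {x} → HalfIntegral x → ∃[ a ] ∃[ b ] x ≡ (κ a ℚ.+ κ b ℚ.* 0ℚ) +√ (κ b ℚ.* 1ℚ)
    go (halves {T} {Y} {N} rat≡ irr≡ norm≡) with even T Y N norm≡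
    ... | (a , refl) , (b , refl) = a , b , cong₂ _+√_
      (trans rat≡ (trans (cong (ℚ._* ½) (κ-+ a a)) (solve 2 (λ a b → (a :+ a) :* con ½ := a :+ b :* con 0ℚ) refl (κ a) (κ b))))
      (trans irr≡ (trans (cong (ℚ._* ½) (κ-+ b b)) (solve 1 (λ b → (b :+ b) :* con ½ := b :* con 1ℚ) refl (κ b))))

  -- The case d ≡ 3 modulo 4, where T and Y have equal parity and ω = (1 + √-d) / 2 has trace 1 and
  -- norm (1 + d) / 4 = 1 + k.
  basis-½+½√-d : ∀ k → ℤ.+ d ≡ ℤ.+ 3 ℤ.+ k ℤ.* ℤ.+ 4 →
    (∀ T Y N → T ℤ.* T ℤ.+ ℤ.+ d ℤ.* (Y ℤ.* Y) ≡ ℤ.+ 4 ℤ.* N → ∃[ a ] T ≡ a ℤ.+ a ℤ.+ Y) → IntegralBasis d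
  basis-½+½√-d k d≡ same-parity = record
    { τ = 1ℤ ; ν = 1ℤ ℤ.+ k ; p = ½ ; h = ½ ; τ≡ = refl
    ; ν≡ = trans (κ-+ 1ℤ k) (trans
        (solve 1 (λ k → con 1ℚ :+ k := con ½ :* con ½ :+ (con (κ (ℤ.+ 3)) :+ k :* con (κ (ℤ.+ 4))) :* (con ½ :* con ½)) refl (κ k))
        (cong (λ D → ½ ℚ.* ½ ℚ.+ D ℚ.* (½ ℚ.* ½)) (sym (trans (cong κ d≡) (trans (κ-+ (ℤ.+ 3) (k ℤ.* ℤ.+ 4)) (cong (κ (ℤ.+ 3) ℚ.+_) (κ-* k (ℤ.+ 4))))))))
    ; h≢0 = λ ()
    ; spans = λ x-integral → go (integral⇒halfIntegral squarefree x-integral)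
    }
    where
    open ℚ-Solver
    go : ∀ {x} → HalfIntegral x → ∃[ a ] ∃[ b ] x ≡ (κ a ℚ.+ κ b ℚ.* ½) +√ (κ b ℚ.* ½)
    go (halves {T} {Y} {N} rat≡ irr≡ norm≡) with same-parity T Y N norm≡
    ... | a , refl = a , Y , cong₂ _+√_
      (trans rat≡ (trans (cong (ℚ._* ½) (trans (κ-+ (a ℤ.+ a) Y) (cong (ℚ._+ κ Y) (κ-+ a a))))
        (solve 2 (λ a y → (a :+ a :+ y) :* con ½ := a :+ y :* con ½) refl (κ a) (κ Y))))
      irr≡

  integralBasis : IntegralBasis d
  integralBasis = go (d ℕ.% 4) (ℕ.m%n<n d 4) (ℕ.m≡m%n+[m/n]*n d 4)
    where
    k : ℤ
    k = ℤ.+ (d ℕ./ 4)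
    residue-mod-4 : ∀ e → d ≡ e ℕ.+ d ℕ./ 4 ℕ.* 4 → ℤ.+ d ≡ ℤ.+ e ℤ.+ k ℤ.* ℤ.+ 4
    residue-mod-4 e eq = trans (cong ℤ.+_ eq) (trans (ℤ.pos-+ e _) (cong (λ t → ℤ.+ e ℤ.+ t) (ℤ.pos-* (d ℕ./ 4) 4)))
    even : ∀ e → (∀ t y W → bit t ℤ.* bit t ℤ.+ ℤ.+ e ℤ.* (bit y ℤ.* bit y) ≡ ℤ.+ 4 ℤ.* W → t ≡ false × y ≡ false) →
      ℤ.+ d ≡ ℤ.+ e ℤ.+ k ℤ.* ℤ.+ 4 →
      ∀ T Y N → T ℤ.* T ℤ.+ ℤ.+ d ℤ.* (Y ℤ.* Y) ≡ ℤ.+ 4 ℤ.* N → (∃[ h ] T ≡ h ℤ.+ h) × (∃[ g ] Y ≡ g ℤ.+ g)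
    even e residueₑ d≡ T Y N norm≡ with parity T | parity Y
    ... | t , h , refl | y , g , refl with residue (ℤ.+ e) (bit t) (bit y) k h g N (ℤ.+ d) d≡ norm≡
    ... | W , eq with residueₑ t y W eq
    ... | refl , refl = (h , ℤ.+-identityˡ (h ℤ.+ h)) , (g , ℤ.+-identityˡ (g ℤ.+ g))
    same-parity : ℤ.+ d ≡ ℤ.+ 3 ℤ.+ k ℤ.* ℤ.+ 4 →
      ∀ T Y N → T ℤ.* T ℤ.+ ℤ.+ d ℤ.* (Y ℤ.* Y) ≡ ℤ.+ 4 ℤ.* N → ∃[ a ] T ≡ a ℤ.+ a ℤ.+ Y
    same-parity d≡ T Y N norm≡ with parity T | parity Y
    ... | t , h , refl | y , g , refl with residue (ℤ.+ 3) (bit t) (bit y) k h g N (ℤ.+ d) d≡ norm≡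
    ... | W , eq with residue₃ t y W eq
    ... | refl = h ℤ.- g , solve 3 (λ t h g → t :+ (h :+ h) := (h :- g) :+ (h :- g) :+ (t :+ (g :+ g))) refl (bit t) h g
      where open ℤ-Solver
    go : ∀ e → e ℕ.< 4 → d ≡ e ℕ.+ d ℕ./ 4 ℕ.* 4 → IntegralBasis d
    go 0 _ eq with () ← squarefree 2 (ℕ.divides (d ℕ./ 4) eq)
    go 1 _ eq = basis-√-d (even 1 residue₁ (residue-mod-4 1 eq))
    go 2 _ eq = basis-√-d (even 2 residue₂ (residue-mod-4 2 eq))
    go 3 _ eq = basis-½+½√-d k (residue-mod-4 3 eq) (same-parity (residue-mod-4 3 eq))
    go (suc (suc (suc (suc _)))) (s≤s (s≤s (s≤s (s≤s ())))) eq

-- Inverses in ℚ(√-d)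

0<p*p : ∀ {p} → p ≢ 0ℚ → 0ℚ ℚ.< p ℚ.* p
0<p*p {p} p≢0 with ℚ.<-cmp p 0ℚ
... | tri< p<0 _ _ = ℚ.positive⁻¹ _ {{ℚ.neg*neg⇒pos p {{ℚ.negative p<0}} p {{ℚ.negative p<0}}}}
... | tri≈ _ p≡0 _ = contradiction p≡0 p≢0
... | tri> _ _ 0<p = ℚ.positive⁻¹ _ {{ℚ.pos*pos⇒pos p {{ℚ.positive 0<p}} p {{ℚ.positive 0<p}}}}

0≤p*p : ∀ p → 0ℚ ℚ.≤ p ℚ.* p
0≤p*p p with p ℚ.≟ 0ℚ
... | yes refl = ℚ.≤-refl
... | no  p≢0  = ℚ.<⇒≤ (0<p*p p≢0)

-- The conjugate divided by the norm p² + d q², which is positive because d > 0.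
inverse : ∀ {d} → Squarefree d → ∀ (x : ℚ√- d) → x ≢ RawRing.0# (ℚ√-rawRing d) →
  ∃[ y ] RawRing._*_ (ℚ√-rawRing d) x y ≡ RawRing.1# (ℚ√-rawRing d)
inverse {zero} squarefree with () ← squarefree 2 (4 ℕ.∣0)
inverse {d@(suc _)} squarefree (p +√ q) x≢0 = (p ℚ.* n⁻¹) +√ (ℚ.- q ℚ.* n⁻¹) , cong₂ _+√_
  (trans (rationalise (κ (ℤ.+ d)) n⁻¹) (ℚ.*-inverseʳ n))
  (solve 3 (λ p q i → p :* (:- q :* i) :+ q :* (p :* i) := con 0ℚ) refl p q n⁻¹)
  where
  open ℚ-Solver
  n : ℚ
  n = p ℚ.* p ℚ.+ κ (ℤ.+ d) ℚ.* (q ℚ.* q)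
  0<d : 0ℚ ℚ.< κ (ℤ.+ d)
  0<d = subst (0ℚ ℚ.<_) (sym (κ≡fromℤ (ℤ.+ d))) (ℚ.positive⁻¹ (fromℤ (ℤ.+ d)))
  0<n : 0ℚ ℚ.< n
  0<n with q ℚ.≟ 0ℚ
  ... | no q≢0 = ℚ.+-mono-≤-< (0≤p*p p) (ℚ.positive⁻¹ _ {{ℚ.pos*pos⇒pos (κ (ℤ.+ d)) {{ℚ.positive 0<d}} (q ℚ.* q) {{ℚ.positive (0<p*p q≢0)}}}})
  ... | yes refl = subst (0ℚ ℚ.<_) (sym (trans (cong (p ℚ.* p ℚ.+_) (ℚ.*-zeroʳ (κ (ℤ.+ d)))) (ℚ.+-identityʳ (p ℚ.* p))))
    (0<p*p λ p≡0 → x≢0 (cong (_+√ 0ℚ) p≡0))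
  instance
    n-nonZero : ℚ.NonZero n
    n-nonZero = ℚ.>-nonZero 0<n
  n⁻¹ : ℚ
  n⁻¹ = ℚ.1/ n
  rationalise : ∀ D i → p ℚ.* (p ℚ.* i) ℚ.- D ℚ.* (q ℚ.* (ℚ.- q ℚ.* i)) ≡ (p ℚ.* p ℚ.+ D ℚ.* (q ℚ.* q)) ℚ.* i
  rationalise D i = solve 4 (λ D p q i → p :* (p :* i) :- D :* (q :* (:- q :* i)) := (p :* p :+ D :* (q :* q)) :* i) refl D p q i

-- The Hermitian form

unit : Sign → ℚ
unit Sign.+ = 1ℚ
unit Sign.- = ℚ.- 1ℚ

odd≢0 : ∀ s t r → unit s ℚ.+ unit t ℚ.- unit r ≢ 0ℚ
odd≢0 Sign.+ Sign.+ Sign.+ ()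
odd≢0 Sign.+ Sign.+ Sign.- ()
odd≢0 Sign.+ Sign.- Sign.+ ()
odd≢0 Sign.+ Sign.- Sign.- ()
odd≢0 Sign.- Sign.+ Sign.+ ()
odd≢0 Sign.- Sign.+ Sign.- ()
odd≢0 Sign.- Sign.- Sign.+ ()
odd≢0 Sign.- Sign.- Sign.- ()

open Signed ⊞-abelianGroup using () renaming (_◃_ to infixr 8 _◃ℝ_)

seq-◃ℝ : ∀ s x n → seq (s ◃ℝ x) n ≡ unit s ℚ.* seq x n
seq-◃ℝ Sign.+ x n = sym (ℚ.*-identityˡ (seq x n))
seq-◃ℝ Sign.- x n = trans (seq-⊟ x n) (solve 1 (λ p → :- p := con (ℚ.- 1ℚ) :* p) refl (seq x n))
  where open ℚ-Solver

-- The difference of the two sides is k x, where k = ±1 ± 1 ± 1 is odd and hence nonzero.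
±x±x≄±x : ∀ {x} → 0ℝ <ℝ x → ∀ s t r → ¬ (s ◃ℝ x ⊞ t ◃ℝ x ≃ r ◃ℝ x)
±x±x≄±x {x} 0<x s t r eq = multiple≄0 (odd≢0 s t r) 0<x (begin
  fromℚ k ⊠ x                         ≈⟨ pointwise expand ⟩
  s ◃ℝ x ⊞ t ◃ℝ x ⊞ ⊟ (r ◃ℝ x)        ≈⟨ ∙-congʳ eq ⟩
  r ◃ℝ x ⊞ ⊟ (r ◃ℝ x)                 ≈⟨ inverseʳ (r ◃ℝ x) ⟩
  0ℝ                                  ∎)
  where
  open AbelianGroup ⊞-abelianGroup using (∙-congʳ; inverseʳ)
  open ≈-Reasoning (AbelianGroup.setoid ⊞-abelianGroup)
  k : ℚ
  k = unit s ℚ.+ unit t ℚ.- unit r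
  expand : ∀ n → seq (fromℚ k ⊠ x) n ≡ seq (s ◃ℝ x ⊞ t ◃ℝ x ⊞ ⊟ (r ◃ℝ x)) n
  expand n
    rewrite seq-⊠ (fromℚ k) x n | seq-⊞ (s ◃ℝ x ⊞ t ◃ℝ x) (⊟ (r ◃ℝ x)) n | seq-⊞ (s ◃ℝ x) (t ◃ℝ x) n
          | seq-⊟ (r ◃ℝ x) n | seq-◃ℝ s x n | seq-◃ℝ t x n | seq-◃ℝ r x n =
    solve 4 (λ s t r x → (s :+ t :- r) :* x := s :* x :+ t :* x :- r :* x) refl (unit s) (unit t) (unit r) (seq x n)
    where open ℚ-Solver

private module ℂᵣ = RawRing ℂ-rawRing

-- A general ℝ-linear functional on ℂ. Each entry of the Hermitian form is such a functional of
-- either argument, which is where additivity comes from.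
linear : ℝ → ℝ → ℂ → ℝ
linear p q z = p ⊠ re z ⊞ q ⊠ im z

seq-linear : ∀ p q z n → seq (linear p q z) n ≡ seq p n ℚ.* seq (re z) n ℚ.+ seq q n ℚ.* seq (im z) n
seq-linear p q z n = trans (seq-⊞ (p ⊠ re z) (q ⊠ im z) n) (cong₂ ℚ._+_ (seq-⊠ p (re z) n) (seq-⊠ q (im z) n))

opaque
  unfolding _⊞_

  ≈+ℝ⇒≃⊞ : ∀ {x y z} → x ≈ℝ y +ℝ z → x ≃ y ⊞ z
  ≈+ℝ⇒≃⊞ = approx

linear-+ : ∀ p q {z z₁ z₂} → z ≈ℂ z₁ ℂᵣ.+ z₂ → linear p q z ≃ linear p q z₁ ⊞ linear p q z₂
linear-+ p q {z} {z₁} {z₂} (re≈ , im≈) = ≃-trans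
  (⊞-cong (⊠-congˡ (≈+ℝ⇒≃⊞ {re z} {re z₁} {re z₂} re≈)) (⊠-congˡ (≈+ℝ⇒≃⊞ {im z} {im z₁} {im z₂} im≈)))
  (pointwise expand)
  where
  open ℚ-Solver
  expand : ∀ n → seq (p ⊠ (re z₁ ⊞ re z₂) ⊞ q ⊠ (im z₁ ⊞ im z₂)) n ≡ seq (linear p q z₁ ⊞ linear p q z₂) n
  expand n
    rewrite seq-⊞ (p ⊠ (re z₁ ⊞ re z₂)) (q ⊠ (im z₁ ⊞ im z₂)) n | seq-⊞ (linear p q z₁) (linear p q z₂) n
          | seq-⊠ p (re z₁ ⊞ re z₂) n | seq-⊠ q (im z₁ ⊞ im z₂) n | seq-⊞ (re z₁) (re z₂) n | seq-⊞ (im z₁) (im z₂) n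
          | seq-linear p q z₁ n | seq-linear p q z₂ n =
    solve 6 (λ p q x₁ x₂ y₁ y₂ → p :* (x₁ :+ x₂) :+ q :* (y₁ :+ y₂) := (p :* x₁ :+ q :* y₁) :+ (p :* x₂ :+ q :* y₂)) refl
      (seq p n) (seq q n) (seq (re z₁) n) (seq (re z₂) n) (seq (im z₁) n) (seq (im z₂) n)

opaque
  term : ℂ → ℂ → ℂ → ℝ
  term z a w = re (conj z ℂᵣ.* a ℂᵣ.* w)

  seq-term : ∀ z a w n → seq (term z a w) n ≡
    (seq (re z) n ℚ.* seq (re a) n ℚ.+ ℚ.- (ℚ.- seq (im z) n ℚ.* seq (im a) n)) ℚ.* seq (re w) n
    ℚ.+ ℚ.- ((seq (re z) n ℚ.* seq (im a) n ℚ.+ ℚ.- seq (im z) n ℚ.* seq (re a) n) ℚ.* seq (im w) n)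
  seq-term z a w n = refl

-- Re(z̄ a w) = Re(a w) Re z + Im(a w) Im z.
term≃linearˡ : ∀ z a w → term z a w ≃ linear (re a ⊠ re w ⊞ ⊟ (im a ⊠ im w)) (im a ⊠ re w ⊞ re a ⊠ im w) z
term≃linearˡ z a w = pointwise expand
  where
  open ℚ-Solver
  expand : ∀ n → seq (term z a w) n ≡ seq (linear (re a ⊠ re w ⊞ ⊟ (im a ⊠ im w)) (im a ⊠ re w ⊞ re a ⊠ im w) z) n
  expand n
    rewrite seq-term z a w n | seq-linear (re a ⊠ re w ⊞ ⊟ (im a ⊠ im w)) (im a ⊠ re w ⊞ re a ⊠ im w) z n
          | seq-⊞ (re a ⊠ re w) (⊟ (im a ⊠ im w)) n | seq-⊟ (im a ⊠ im w) n | seq-⊞ (im a ⊠ re w) (re a ⊠ im w) n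
          | seq-⊠ (re a) (re w) n | seq-⊠ (im a) (im w) n | seq-⊠ (im a) (re w) n | seq-⊠ (re a) (im w) n =
    solve 6 (λ x y a b u v →
      (x :* a :+ :- (:- y :* b)) :* u :+ :- ((x :* b :+ :- y :* a) :* v) := (a :* u :+ :- (b :* v)) :* x :+ (b :* u :+ a :* v) :* y) refl
      (seq (re z) n) (seq (im z) n) (seq (re a) n) (seq (im a) n) (seq (re w) n) (seq (im w) n)

-- Re(z̄ a w) = Re(z̄ a) Re w - Im(z̄ a) Im w.
term≃linearʳ : ∀ z a w → term z a w ≃ linear (re z ⊠ re a ⊞ im z ⊠ im a) (im z ⊠ re a ⊞ ⊟ (re z ⊠ im a)) w
term≃linearʳ z a w = pointwise expand
  where
  open ℚ-Solver
  expand : ∀ n → seq (term z a w) n ≡ seq (linear (re z ⊠ re a ⊞ im z ⊠ im a) (im z ⊠ re a ⊞ ⊟ (re z ⊠ im a)) w) n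
  expand n
    rewrite seq-term z a w n | seq-linear (re z ⊠ re a ⊞ im z ⊠ im a) (im z ⊠ re a ⊞ ⊟ (re z ⊠ im a)) w n
          | seq-⊞ (re z ⊠ re a) (im z ⊠ im a) n | seq-⊞ (im z ⊠ re a) (⊟ (re z ⊠ im a)) n | seq-⊟ (re z ⊠ im a) n
          | seq-⊠ (re z) (re a) n | seq-⊠ (im z) (im a) n | seq-⊠ (im z) (re a) n | seq-⊠ (re z) (im a) n =
    solve 6 (λ x y a b u v →
      (x :* a :+ :- (:- y :* b)) :* u :+ :- ((x :* b :+ :- y :* a) :* v) := (x :* a :+ y :* b) :* u :+ (y :* a :+ :- (x :* b)) :* v) refl
      (seq (re z) n) (seq (im z) n) (seq (re a) n) (seq (im a) n) (seq (re w) n) (seq (im w) n)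

module _ (A : Matrix₂) where

  row : Fin 2 → Vector ℂ 2 → Vector ℂ 2 → ℝ
  row i x y = term (x i) (A i zero) (y zero) ⊞ term (x i) (A i (suc zero)) (y (suc zero))

  -- The real part of x̄ᵗ A y, whose diagonal is `A [ x ]`.
  form : Vector ℂ 2 → Vector ℂ 2 → ℝ
  form x y = row zero x y ⊞ row (suc zero) x y

  seq-row : ∀ i x y n → seq (row i x y) n ≡ seq (term (x i) (A i zero) (y zero)) n ℚ.+ seq (term (x i) (A i (suc zero)) (y (suc zero))) n
  seq-row i x y n = seq-⊞ (term (x i) (A i zero) (y zero)) (term (x i) (A i (suc zero)) (y (suc zero))) n

  seq-form : ∀ x y n → seq (form x y) n ≡ seq (row zero x y) n ℚ.+ seq (row (suc zero) x y) n
  seq-form x y = seq-⊞ (row zero x y) (row (suc zero) x y)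

  opaque
    unfolding term

    seq-[] : ∀ x n → let t = λ i j → seq (term (x i) (A i j) (x j)) n in
      seq (A [ x ]) n ≡ (t zero zero ℚ.+ (t zero (suc zero) ℚ.+ 0ℚ)) ℚ.+ ((t (suc zero) zero ℚ.+ (t (suc zero) (suc zero) ℚ.+ 0ℚ)) ℚ.+ 0ℚ)
    seq-[] x n = refl

  seq-diagonal : ∀ x n → seq (A [ x ]) n ≡ seq (form x x) n
  seq-diagonal x n = trans (seq-[] x n) (trans (solve 4 (λ a b c d → (a :+ (b :+ con 0ℚ)) :+ ((c :+ (d :+ con 0ℚ)) :+ con 0ℚ) := (a :+ b) :+ (c :+ d)) refl
      (t n zero zero) (t n zero (suc zero)) (t n (suc zero) zero) (t n (suc zero) (suc zero)))
      (sym (trans (seq-form x x n) (cong₂ ℚ._+_ (seq-row zero x x n) (seq-row (suc zero) x x n)))))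
    where
    open ℚ-Solver
    t : ℕ → Fin 2 → Fin 2 → ℚ
    t n i j = seq (term (x i) (A i j) (x j)) n

  opaque
    value : Vector ℂ 2 → ℝ
    value x = A [ x ]

    value≈ : ∀ {m x} → A [ x ] ≈ℝ m → value x ≃ m
    value≈ = approx

    ≤value : ∀ {m x} → m ≤ℝ A [ x ] → m ≼ value x
    ≤value = bound

    0<value : ∀ {x} → 0ℝ <ℝ A [ x ] → 0ℝ <ℝ value x
    0<value 0<Ax = 0<Ax

    seq-value : ∀ x n → seq (value x) n ≡ seq (A [ x ]) n
    seq-value x n = refl

  -- Vectors are functions and agree only pointwise, so the form is rewritten as `diagonal`, a
  -- function of the two entries, before equals are substituted.
  value≃form : ∀ {x y} → (∀ i → x i ≡ y i) → value x ≃ form y y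
  value≃form {x} {y} x≡y = ≃-trans (pointwise λ n → trans (seq-value x n) (seq-diagonal x n)) (AbelianGroup.reflexive ⊞-abelianGroup
    (cong₂ diagonal (x≡y zero) (x≡y (suc zero))))
    where
    diagonal : ℂ → ℂ → ℝ
    diagonal x₀ x₁ = (term x₀ (A zero zero) x₀ ⊞ term x₀ (A zero (suc zero)) x₁)
      ⊞ (term x₁ (A (suc zero) zero) x₀ ⊞ term x₁ (A (suc zero) (suc zero)) x₁)

module _ (G : AbelianGroup 0ℓ 0ℓ) where

  open AbelianGroup G using (_∙_; _≈_) renaming (Carrier to L)

  record Additive (φ : L → ℂ) : Set where
    field
      cong-≡ : ∀ {x y} → x ≈ y → φ x ≡ φ y
      homo   : ∀ x y → φ (x ∙ y) ≈ℂ φ x ℂᵣ.+ φ y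

  term-biadditive : ∀ {φ ψ} a → Additive φ → Additive ψ → Biadditive ⊞-abelianGroup G (λ x y → term (φ x) a (ψ y))
  term-biadditive {φ} {ψ} a Φ Ψ = record
    { cong     = λ {x} {x′} {y} {y′} x≈x′ y≈y′ →
        R.reflexive (cong₂ (λ z w → term z a w) (Φ.cong-≡ x≈x′) (Ψ.cong-≡ y≈y′))
    ; distribˡ = λ x y z → R.trans (term≃linearˡ (φ (x ∙ y)) a (ψ z)) (R.trans (linear-+ _ _ (Φ.homo x y))
        (R.sym (R.∙-cong (term≃linearˡ (φ x) a (ψ z)) (term≃linearˡ (φ y) a (ψ z)))))
    ; distribʳ = λ x y z → R.trans (term≃linearʳ (φ x) a (ψ (y ∙ z))) (R.trans (linear-+ _ _ (Ψ.homo y z))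
        (R.sym (R.∙-cong (term≃linearʳ (φ x) a (ψ y)) (term≃linearʳ (φ x) a (ψ z)))))
    }
    where
    module R = AbelianGroup ⊞-abelianGroup
    module Φ = Additive Φ
    module Ψ = Additive Ψ

  form-biadditive : ∀ A {φ : L → Vector ℂ 2} → (∀ i → Additive (λ x → φ x i)) →
    Biadditive ⊞-abelianGroup G (λ x y → form A (φ x) (φ y))
  form-biadditive A {φ} Φ = biadditive-+ _ _ (row-biadditive zero) (row-biadditive (suc zero))
    where
    row-biadditive : ∀ i → Biadditive ⊞-abelianGroup G (λ x y → row A i (φ x) (φ y))
    row-biadditive i = biadditive-+ _ _ (term-biadditive (A i zero) (Φ i) (Φ zero)) (term-biadditive (A i (suc zero)) (Φ i) (Φ (suc zero)))

-- Nonvanishing of complex units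

1²+0²≃1 : ∀ {x y} → x ≃ 1ℝ → y ≃ 0ℝ → x ⊠ x ⊞ y ⊠ y ≃ 1ℝ
1²+0²≃1 x≃1 y≃0 = ≃-trans (⊞-cong (⊠-cong x≃1 x≃1) (⊠-cong y≃0 y≃0)) (pointwise λ n →
  trans (seq-⊞ (1ℝ ⊠ 1ℝ) (0ℝ ⊠ 0ℝ) n) (cong₂ ℚ._+_ (seq-⊠ 1ℝ 1ℝ n) (seq-⊠ 0ℝ 0ℝ n)))

∣_∣² : ℂ → ℝ
∣ z ∣² = re z *ℝ re z +ℝ im z *ℝ im z

∣z∣²⊠∣w∣²≃∣z*w∣² : ∀ z w → let zw = z ℂᵣ.* w in ∣ z ∣² ⊠ ∣ w ∣² ≃ re zw ⊠ re zw ⊞ im zw ⊠ im zw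
∣z∣²⊠∣w∣²≃∣z*w∣² z w = pointwise λ n → trans (seq-⊠ ∣ z ∣² ∣ w ∣² n)
  (trans (brahmagupta (seq (re z) n) (seq (im z) n) (seq (re w) n) (seq (im w) n))
    (sym (trans (seq-⊞ (x ⊠ x) (y ⊠ y) n) (cong₂ ℚ._+_ (seq-⊠ x x n) (seq-⊠ y y n)))))
  where
  open ℚ-Solver
  x y : ℝ
  x = re (z ℂᵣ.* w)
  y = im (z ℂᵣ.* w)
  brahmagupta : ∀ a b u v → (a ℚ.* a ℚ.+ b ℚ.* b) ℚ.* (u ℚ.* u ℚ.+ v ℚ.* v) ≡
    (a ℚ.* u ℚ.+ ℚ.- (b ℚ.* v)) ℚ.* (a ℚ.* u ℚ.+ ℚ.- (b ℚ.* v)) ℚ.+ (a ℚ.* v ℚ.+ b ℚ.* u) ℚ.* (a ℚ.* v ℚ.+ b ℚ.* u)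
  brahmagupta = solve 4 (λ a b u v → (a :* a :+ b :* b) :* (u :* u :+ v :* v)
      := (a :* u :+ :- (b :* v)) :* (a :* u :+ :- (b :* v)) :+ (a :* v :+ b :* u) :* (a :* v :+ b :* u)) refl

-- From ∣z∣² ∣w∣² = ∣z w∣² = 1, the bound on ∣w∣² gives ∣z∣² a positive margin. In use, t is the
-- image under σ of a product equal to 1.
unit⇒nonZero : ∀ {z w t} → t ≈ℂ z ℂᵣ.* w → t ≈ℂ ℂᵣ.1# → NonZeroℂ z
unit⇒nonZero {z} {w} {t} (re≈ , im≈) (re≈1 , im≈0) = x⊠y≃1⇒0<x {∣ z ∣²} {∣ w ∣²}
  (λ n → ℚ.+-mono-≤ (0≤p*p (seq (re z) n)) (0≤p*p (seq (im z) n)))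
  (≃-trans (∣z∣²⊠∣w∣²≃∣z*w∣² z w) (1²+0²≃1
    (≃-trans {re (z ℂᵣ.* w)} {re t} (≃-sym {re t} (approx re≈)) (approx re≈1))
    (≃-trans {im (z ℂᵣ.* w)} {im t} (≃-sym {im t} (approx im≈)) (approx im≈0))))

-- Reduction of ℤ⁴ modulo 2

xor-even : ∀ b c → ∃[ e ] bit b ℤ.+ bit c ℤ.+ bit (b xor c) ≡ e ℤ.+ e
xor-even false false = 0ℤ , refl
xor-even false true  = 1ℤ , refl
xor-even true  false = 1ℤ , refl
xor-even true  true  = 1ℤ , refl

odd? : ℤ → Bool
odd? z = proj₁ (parity z)

half-sum : ∀ a b c → odd? c ≡ odd? a xor odd? b → ∃[ u ] a ℤ.+ b ℤ.+ c ≡ u ℤ.+ u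
half-sum a b c eq = go (parity a) (parity b) (parity c) eq
  where
  open ℤ-Solver
  go : (A : ∃[ s ] ∃[ h ] a ≡ bit s ℤ.+ (h ℤ.+ h)) (B : ∃[ s ] ∃[ h ] b ≡ bit s ℤ.+ (h ℤ.+ h))
    (C : ∃[ s ] ∃[ h ] c ≡ bit s ℤ.+ (h ℤ.+ h)) → proj₁ C ≡ proj₁ A xor proj₁ B → ∃[ u ] a ℤ.+ b ℤ.+ c ≡ u ℤ.+ u
  go (s , h , a≡) (t , g , b≡) (_ , k , c≡) refl with xor-even s t
  ... | e , bits≡ = e ℤ.+ (h ℤ.+ g ℤ.+ k) , trans (cong₂ ℤ._+_ (cong₂ ℤ._+_ a≡ b≡) c≡) (trans
    (solve 6 (λ s h t g r k → (s :+ (h :+ h)) :+ (t :+ (g :+ g)) :+ (r :+ (k :+ k)) := (s :+ t :+ r) :+ ((h :+ g :+ k) :+ (h :+ g :+ k))) refl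
      (bit s) h (bit t) g (bit (s xor t)) k)
    (trans (cong (ℤ._+ ((h ℤ.+ g ℤ.+ k) ℤ.+ (h ℤ.+ g ℤ.+ k))) bits≡)
      (solve 2 (λ e m → (e :+ e) :+ (m :+ m) := (e :+ m) :+ (e :+ m)) refl e (h ℤ.+ g ℤ.+ k))))

ℤ⁴ : AbelianGroup 0ℓ 0ℓ
ℤ⁴ = abelianGroup (abelianGroup ℤ.+-0-abelianGroup ℤ.+-0-abelianGroup) (abelianGroup ℤ.+-0-abelianGroup ℤ.+-0-abelianGroup)

module ℤ⁴ where
  open AbelianGroup ℤ⁴ public
  open Signed ℤ⁴ public

_≟ℤ⁴_ : Decidable ℤ⁴._≈_
_≟ℤ⁴_ = ×-decidable (×-decidable ℤ._≟_ ℤ._≟_) (×-decidable ℤ._≟_ ℤ._≟_)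

class : ℤ⁴.Carrier → Point
class ((a , b) , (c , d)) = odd? a ∷ odd? b ∷ odd? c ∷ odd? d ∷ []

half-class : ∀ u v w → class w ≡ class u ⊕ class v → ∃[ t ] u ℤ⁴.∙ v ℤ⁴.∙ w ℤ⁴.≈ t ℤ⁴.∙ t
half-class ((a , b) , (c , d)) ((a′ , b′) , (c′ , d′)) ((a″ , b″) , (c″ , d″)) eq =
  let e₁ , eq₁ = ∷-injective eq
      e₂ , eq₂ = ∷-injective eq₁
      e₃ , eq₃ = ∷-injective eq₂
      e₄ , _   = ∷-injective eq₃
      h₁ , s₁  = half-sum a a′ a″ e₁
      h₂ , s₂  = half-sum b b′ b″ e₂
      h₃ , s₃  = half-sum c c′ c″ e₃
      h₄ , s₄  = half-sum d d′ d″ e₄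
  in ((h₁ , h₂) , (h₃ , h₄)) , ((s₁ , s₂) , (s₃ , s₄))

-- Minimal vectors as short vectors of ℤ⁴

module _ {d : ℕ} (squarefree : Squarefree d) (basis : IntegralBasis d)
  (σ : ℚ√- d → ℂ) (embedding : IsComplexEmbedding d σ) (A : Matrix₂) (positive : PositiveDefinite A) where

  open RawRing (ℚ√-rawRing d) using (_+_; _*_; -_; 0#; 1#)
  open RingMorphisms (ℚ√-rawRing d) ℂ-rawRing using (module IsRingMonomorphism)
  open IsRingMonomorphism embedding using (+-homo; *-homo; 1#-homo)
  open IntegralBasis basis

  _≟√_ : Decidable (_≡_ {A = ℚ√- d})
  (p +√ q) ≟√ (r +√ s) with p ℚ.≟ r | q ℚ.≟ s
  ... | yes refl | yes refl = yes refl
  ... | no p≢r   | _        = no λ eq → p≢r (cong rat eq)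
  ... | yes _    | no q≢s   = no λ eq → q≢s (cong irr eq)

  lattice : ℤ⁴.Carrier → Vector (ℚ√- d) 2
  lattice ((a , b) , _) zero       = element a b
  lattice (_ , (a , b)) (suc zero) = element a b

  lattice-cong : ∀ {u v} → u ℤ⁴.≈ v → ∀ i → lattice u i ≡ lattice v i
  lattice-cong ((refl , refl) , (refl , refl)) i = refl

  lattice-+ : ∀ u v i → lattice (u ℤ⁴.∙ v) i ≡ lattice u i + lattice v i
  lattice-+ ((a , b) , _) ((a′ , b′) , _) zero       = element-+ a b a′ b′
  lattice-+ (_ , (a , b)) (_ , (a′ , b′)) (suc zero) = element-+ a b a′ b′

  lattice-neg : ∀ u i → lattice (u ℤ⁴.⁻¹) i ≡ - lattice u i
  lattice-neg ((a , b) , _) zero       = element-neg a b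
  lattice-neg (_ , (a , b)) (suc zero) = element-neg a b

  lattice-nonzeroIntegral : ∀ u → ¬ u ℤ⁴.≈ ℤ⁴.ε → NonzeroIntegral (lattice u)
  lattice-nonzeroIntegral u@((a , b) , (a′ , b′)) u≉0 =
    (λ { zero → element-integral a b ; (suc zero) → element-integral a′ b′ }) ,
    λ eq → u≉0 (element-injective₀ (eq zero) , element-injective₀ (eq (suc zero)))

  σ-additive : ∀ i → Additive ℤ⁴ (λ u → σ (lattice u i))
  σ-additive i = record
    { cong-≡ = λ u≈v → cong σ (lattice-cong u≈v i)
    ; homo   = λ u v → subst (λ x → σ x ≈ℂ σ (lattice u i) ℂᵣ.+ σ (lattice v i)) (sym (lattice-+ u v i)) (+-homo (lattice u i) (lattice v i))
    }

  f : ℤ⁴.Carrier → ℤ⁴.Carrier → ℝ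
  f u v = form A (λ i → σ (lattice u i)) (λ i → σ (lattice v i))

  f-biadditive : Biadditive ⊞-abelianGroup ℤ⁴ f
  f-biadditive = form-biadditive ℤ⁴ A σ-additive

  value≃f : ∀ {v : Vector (ℚ√- d) 2} u → (∀ i → v i ≡ lattice u i) → value A (λ i → σ (v i)) ≃ f u u
  value≃f {v} u v≡u = value≃form A {λ i → σ (v i)} {λ i → σ (lattice u i)} (λ i → cong σ (v≡u i))

  coordinates : ∀ {v : Vector (ℚ√- d) 2} → (∀ i → IsIntegral (v i)) → ∃[ u ] (∀ i → v i ≡ lattice u i)
  coordinates integral with spans (integral zero) | spans (integral (suc zero))
  ... | a , b , eq | a′ , b′ , eq′ = ((a , b) , (a′ , b′)) , λ { zero → eq ; (suc zero) → eq′ }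

  -- Positive definiteness is stated for vectors with an entry of positive absolute square; the
  -- relation σ x · σ y = 1 provides that positivity for x ≠ 0.
  σ-nonZero : ∀ {x} → x ≢ 0# → NonZeroℂ (σ x)
  σ-nonZero {x} x≢0 with inverse squarefree x x≢0
  ... | y , xy≡1 = unit⇒nonZero {σ x} {σ y} {σ (x * y)} (*-homo x y) (subst (λ t → σ t ≈ℂ ℂᵣ.1#) (sym xy≡1) 1#-homo)

  value>0 : ∀ {v : Vector (ℚ√- d) 2} → NonzeroIntegral v → 0ℝ <ℝ value A (λ i → σ (v i))
  value>0 {v} (_ , v≢0) = 0<value A {λ i → σ (v i)} (positive (λ i → σ (v i)) nonZero)
    where
    nonZero : ∃[ i ] NonZeroℂ (σ (v i))
    nonZero with v zero ≟√ 0# | v (suc zero) ≟√ 0#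
    ... | no v₀≢0  | _         = zero , σ-nonZero v₀≢0
    ... | yes _    | no v₁≢0   = suc zero , σ-nonZero v₁≢0
    ... | yes v₀≡0 | yes v₁≡0  = contradiction (λ { zero → v₀≡0 ; (suc zero) → v₁≡0 }) v≢0

  module _ {m : ℝ} (m-min : IsMin σ A m) (0<m : 0ℝ <ℝ m) where

    m≼f : ∀ u → ¬ u ℤ⁴.≈ ℤ⁴.ε → m ≼ f u u
    m≼f u u≉0 = ≼-trans (≤value A {x = λ i → σ (lattice u i)} (proj₁ m-min (lattice u) (lattice-nonzeroIntegral u u≉0)))
      (≃⇒≼ (value≃f u λ _ → refl))

    open ShortVectors ⊞-abelianGroup ℤ⁴ _≼_ ≃⇒≼ ≼-trans ⊞-mono-≼ (<⇒≼ 0<m) (x⊞y⋠x 0<m) (±x±x≄±x 0<m)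
      _≟ℤ⁴_ f-biadditive m≼f class refl half-class

    Realised : Point → Set
    Realised p = ∃[ u ] Minimal u × class u ≡ p

    no-realised-hyperplane : ∀ h → ¬ All Realised (span h)
    no-realised-hyperplane (_ , _ , _) ((a , a-min , refl) ∷ (b , b-min , refl) ∷ (c , c-min , refl) ∷
        (ab , ab-min , ab≡) ∷ (ac , ac-min , ac≡) ∷ (bc , bc-min , bc≡) ∷ (abc , abc-min , abc≡) ∷ []) =
      no-minimal-plane {a} {b} {c} {ab} {ac} {bc} {abc} a-min b-min c-min ab-min ac-min bc-min abc-min
        ab≡ ac≡ bc≡ (trans abc≡ (cong (_⊕ class c) (sym ab≡)))

    opaque
      minimalVector : ((v , _) : Setoid.Carrier (Min σ A)) → ∃[ u ] Minimal u × (∀ i → v i ≡ lattice u i)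
      minimalVector (v , nonzeroIntegral@(integral , _) , m′ , m′-min , value≈m′) with coordinates integral
      ... | u , v≡u = u , ≃-trans (≃-sym (value≃f {v} u v≡u)) (≃-trans (value≈ A {x = λ i → σ (v i)} value≈m′) m′≃m) , v≡u
        where
        -- Each minimal vector carries a minimum of its own; two greatest lower bounds of the same
        -- values bound each other.
        m′≃m : m′ ≃ m
        m′≃m = ≼-antisym (bound (proj₂ m-min m′ (proj₁ m′-min))) (bound (proj₂ m′-min m (proj₁ m-min)))

    minimalClass : Setoid.Carrier (Min σ A) → Point
    minimalClass x = class (proj₁ (minimalVector x))

    realised : ∀ x → Realised (minimalClass x)
    realised x = let u , u-min , _ = minimalVector x in u , u-min , refl

    signed⇒≈± : ∀ {v v′ : Vector (ℚ√- d) 2} {u w} s → (∀ i → v i ≡ lattice u i) → (∀ i → v′ i ≡ lattice w i) →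
      u ℤ⁴.≈ s ℤ⁴.◃ w → v ≈± v′
    signed⇒≈± Sign.+ v≡u v′≡w u≈w = inj₁ λ i → trans (v≡u i) (trans (lattice-cong u≈w i) (sym (v′≡w i)))
    signed⇒≈± {w = w} Sign.- v≡u v′≡w u≈-w = inj₂ λ i →
      trans (v≡u i) (trans (lattice-cong u≈-w i) (trans (lattice-neg w i) (cong -_ (sym (v′≡w i)))))

    minimalClass-injective : ∀ x y → minimalClass x ≡ minimalClass y → proj₁ x ≈± proj₁ y
    minimalClass-injective x y eq =
      let u , u-min , x≡u = minimalVector x
          w , w-min , y≡w = minimalVector y
          s , u≈sw        = class-injective {u} {w} u-min w-min eq
      in signed⇒≈± {proj₁ x} {proj₁ y} {u} {w} s x≡u y≡w u≈sw

    length≤12 : # (Min σ A) ≤ 12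
    length≤12 xs unique = subst (ℕ._≤ 12) (length-map minimalClass xs) (no-hyperplane⇒length≤12
      (AllPairs.map⁺ (AllPairs.map (λ {x} {y} x≉y eq → x≉y (minimalClass-injective x y eq)) unique))
      (map⁺ (universal (λ x → class-nonzero {proj₁ (minimalVector x)} (proj₁ (proj₂ (minimalVector x)))) xs))
      (λ h span⊆ → no-realised-hyperplane h (All.map (λ {p} → realised-∈ {p}) span⊆)))
      where
      realised-∈ : ∀ {p} → p ∈ map minimalClass xs → Realised p
      realised-∈ p∈ = let x , _ , p≡ = ∈-map⁻ minimalClass p∈ in subst Realised (sym p≡) (realised x)

theorem4p1 :
    ∀ (d : ℕ) → Squarefree d →
    ∀ (σ : ℚ√- d → ℂ) → IsComplexEmbedding d σ →
    ∀ (A : Matrix₂) → Hermitian A → PositiveDefinite A →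
    # (Min σ A) ≤ 12
theorem4p1 d squarefree σ embedding A _ positive []       _      = ℕ.z≤n
-- The first entry of the list supplies the minimum m, and m > 0 because it is the value of A at
-- that nonzero vector.
theorem4p1 d squarefree σ embedding A _ positive xs@((v , nonzeroIntegral , m , m-min , value≈m) ∷ _) unique =
  length≤12 squarefree basis σ embedding A positive {m} m-min
    (0<-resp-≃ (value≈ A {m} {λ i → σ (v i)} value≈m)
      (value>0 squarefree basis σ embedding A positive {v} nonzeroIntegral)) xs unique
  where basis = integralBasis squarefree
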